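{- Let $k\ge 3$ and $t\ge 2$ be integers. Let $U_t(A,B)$ denote the number of solutions of $$\sum_{j=1}^t a_j(x_j^k-y_j^k)=0$$ in integers $a_j,x_j,y_j$ $(1\le j\le t)$ satisfying $0<|a_j|\le A$, $|x_j|\le B$, $|y_j|\le B$. Then, for real numbers $A,B$ with $A\ge 2B^k\ge 1$ and every $\varepsilon>0$, one has $$U_t(A,B)\ll (AB)^t+A^{t-1}B^{2t-k+\varepsilon}.$$
   Context: The implicit constant depends only on $k,t,\varepsilon$.
   Formalization: A, B and ε range over rational numbers instead of real numbers (with B > 0), and the factor B^ε is expressed through every rational r with r ≥ B^ε. -}

module Defs where

open import Data.Nat as ℕ using (ℕ; zero; suc)
open import Data.Integer as ℤ using (ℤ; +_; -[1+_])
open import Data.Rational as ℚ using (ℚ; 0ℚ; 1ℚ; NonZero)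
import Data.Rational.Properties as ℚP
import Data.Integer.Properties as ℤP
open import Data.List as List using (List; []; _∷_; upTo; filter; length; cartesianProduct; concatMap)
open import Data.Vec as Vec using (Vec; []; _∷_)
open import Data.Vec.Relation.Unary.All as All using (All)
open import Data.Product using (_×_; _,_)
open import Relation.Nullary using (Dec)
open import Relation.Nullary.Decidable using (_×-dec_)
open import Relation.Binary.PropositionalEquality using (_≡_)

toℚ : ℤ → ℚ
toℚ m = m ℚ./ 1

_^ℚ_ : ℚ → ℕ → ℚ
b ^ℚ zero  = 1ℚ
b ^ℚ suc n = b ℚ.* (b ^ℚ n)

powℤ : (b : ℚ) → .{{_ : NonZero b}} → ℤ → ℚ
powℤ b (+ n)     = b ^ℚ n
powℤ b -[1+ n ]  = (ℚ.1/ b) ^ℚ suc n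

intRange : ℕ → List ℤ
intRange N = List.map (λ i → (+ i) ℤ.- (+ N)) (upTo (suc (2 ℕ.* N)))

vecs : {X : Set} → List X → (n : ℕ) → List (Vec X n)
vecs xs zero    = [] ∷ []
vecs xs (suc n) = concatMap (λ x → List.map (x ∷_) (vecs xs n)) xs

Triple : Set
Triple = ℤ × ℤ × ℤ

InBox : ℚ → ℚ → Triple → Set
InBox A B (a , x , y) =
  (0ℚ ℚ.< ℚ.∣ toℚ a ∣ × ℚ.∣ toℚ a ∣ ℚ.≤ A) × (ℚ.∣ toℚ x ∣ ℚ.≤ B × ℚ.∣ toℚ y ∣ ℚ.≤ B)

inBox? : (A B : ℚ) → (v : Triple) → Dec (InBox A B v)
inBox? A B (a , x , y) =
  ((0ℚ ℚP.<? ℚ.∣ toℚ a ∣) ×-dec (ℚ.∣ toℚ a ∣ ℚP.≤? A))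
  ×-dec ((ℚ.∣ toℚ x ∣ ℚP.≤? B) ×-dec (ℚ.∣ toℚ y ∣ ℚP.≤? B))

formSum : (k : ℕ) → {t : ℕ} → Vec Triple t → ℤ
formSum k []                  = + 0
formSum k ((a , x , y) ∷ v) = a ℤ.* ((x ℤ.^ k) ℤ.- (y ℤ.^ k)) ℤ.+ formSum k v

IsSol : (k : ℕ) → (A B : ℚ) → {t : ℕ} → Vec Triple t → Set
IsSol k A B v = All (InBox A B) v × (formSum k v ≡ + 0)

isSol? : (k : ℕ) → (A B : ℚ) → {t : ℕ} → (v : Vec Triple t) → Dec (IsSol k A B v)
isSol? k A B v = All.all? (inBox? A B) v ×-dec (formSum k v ℤP.≟ + 0)

-- Every integer satisfying |a| ≤ A lies in [-|⌊A⌋|, |⌊A⌋|] (likewise for B),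
-- so counting solutions inside this finite candidate set counts all of them.
candidates : (A B : ℚ) → List Triple
candidates A B =
  cartesianProduct (intRange ℤ.∣ ℚ.floor A ∣)
    (cartesianProduct (intRange ℤ.∣ ℚ.floor B ∣) (intRange ℤ.∣ ℚ.floor B ∣))

U : (k t : ℕ) → (A B : ℚ) → ℕ
U k t A B = length (filter (isSol? k A B) (vecs (candidates A B) t))

-- Put e = ||x| - |y|| and d = x^k - y^k, so that e^k ≤ |d|, and single out in a solution a triple
-- i with e_i maximal.  If e_i = 0, every triple has O(AB) possible values.  Otherwise a_i is
-- determined by the remaining triples, which satisfy d_i ∣ Σ_{j≠i} a_j d_j.  Removing them one at a
-- time, with the modulus D replaced by gcd (d_j , D) at each step, shows that their number is
-- ≪ (A Z)^(t-1) max_{g ∣ d_i} g N_g^(t-1) / |d_i|, where N_g counts the pairs with e ≤ e_i and g ∣ d,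
-- and Z = B^ε bounds the divisor function.  A monic polynomial of degree k has
-- ≪ Z^(k-1) (L g^(-1/k) + 1) roots modulo g in an interval of length L, so
-- N_g ≪ B Z^(k-1) (e_i g^(-1/k) + 1).  For t > k the maximum is therefore
-- ≪ (B Z^(k-1))^(t-1) |d_i| B^(t-1-k), which gives the second term of the theorem.  For t ≤ k the
-- trivial bound A^(t-1) B^(2t) is already ≤ (AB)^t.

module Submission where

open import Defs
open import Data.Nat as ℕ using (ℕ; suc; _≤_; _∸_; zero; _+_; _*_; _^_; _<_; z≤n; s≤s; NonZero; _≤?_)
open import Data.Nat.Properties
open import Data.Nat.Divisibility as ℕD using (∣⇒≤)
open import Data.Nat.DivMod using (_/_; _%_; m≡m%n+[m/n]*n; m%n<n; m/n*n≤m; /-monoˡ-≤; m*n/n≡m)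
open import Data.Nat.GCD using (gcd; gcd[m,n]∣m; gcd[m,n]∣n; gcd-greatest; c*gcd[m,n]≡gcd[cm,cn])
open import Data.Nat.Coprimality using (Coprime; coprime-divisor)
open import Data.Nat.ListAction using (product)
open import Data.Nat.Primality
open import Data.Nat.Primality.Factorisation using (PrimeFactorisation; factorise)
open import Data.Nat.Tactic.RingSolver using (solve-∀)
open import Data.Integer as ℤ using (ℤ; +_; -[1+_]) renaming (∣_∣ to abs)
import Data.Integer.Properties as ℤP
open import Data.Integer.Divisibility.Signed as ℤD using (_∣_; _∣?_; ∣⇒∣ᵤ; ∣ᵤ⇒∣; divides)
import Data.Integer.Tactic.RingSolver as ℤSolver
import Algebra.Properties.AbelianGroup ℤP.+-0-abelianGroup as ℤGroup
open import Data.Rational as ℚ using (ℚ; mkℚ; 0ℚ; 1ℚ)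
open import Data.Rational.Base using (>-nonZero)
import Data.Rational.Properties as ℚP
open import Data.Rational.Unnormalised as ℚᵘ using (mkℚᵘ)
import Data.Rational.Unnormalised.Properties as ℚᵘP
open import Algebra.Bundles using (CommutativeRing)
import Algebra.Properties.CommutativeSemigroup (CommutativeRing.*-commutativeSemigroup ℚP.+-*-commutativeRing) as ℚ*
open import Data.Fin using (Fin; zero; suc)
open import Data.List as List using (List; []; _∷_; _++_; length; map; filter; concatMap; cartesianProduct; upTo; applyUpTo; allFin)
open import Data.List.Properties using (length-map; length-upTo; length-tabulate)
open import Data.List.Relation.Unary.Any using (here; there)
open import Data.List.Relation.Unary.All as ListAll using ([]; _∷_)
open import Data.List.Relation.Unary.AllPairs using ([]; _∷_)
open import Data.List.Relation.Unary.Unique.Propositional using (Unique)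
open import Data.List.Relation.Unary.Unique.Propositional.Properties using (upTo⁺; filter⁺)
open import Data.List.Membership.Propositional using (_∈_; lose)
open import Data.List.Membership.Propositional.Properties
open import Data.Vec as Vec using (Vec; []; _∷_; lookup; removeAt)
open import Data.Vec.Relation.Unary.All as All using (All; []; _∷_)
open import Data.Product using (Σ; _×_; _,_; proj₁; proj₂; ∃)
open import Data.Sum using (_⊎_; inj₁; inj₂)
open import Data.Empty using (⊥-elim)
open import Relation.Nullary using (Dec; yes; no; ¬_)
open import Relation.Nullary.Decidable using (_×-dec_)
open import Relation.Unary using (Decidable)
open import Relation.Binary.PropositionalEquality using (_≡_; _≢_; refl; sym; trans; cong; cong₂; subst; subst₂; module ≡-Reasoning)

-- Dividing by |d_i| is costly when d_i is small, and about B^2 pairs (x_i , y_i) have to be summed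
-- over. Maximality of e_i is the cure: it confines all other pairs to windows of length O(e_i).
-- With n = t - 1 their counts contribute about e_i^n g^(-n/k). The modulus g is absorbed because n
-- ≥ k, and e_i^n ≤ |d_i| B^(n-k) supplies exactly the factor |d_i| that is divided out. All pairs i
-- then share one bound, and no sum of 1 / |d_i| arises. The hypothesis A ≥ 2 B^k enters through
-- |d_i| ≤ 2 B^k ≤ A: residue classes modulo divisors of d_i meet [-A , A] in O(A / modulus) points,
-- without an extra + 1. The counting takes place in ℕ, for the integer parts a and b of A and B.
-- Quotients are avoided by multiplying counts by the modulus or by w, real powers by integer parts
-- of roots. The divisor bound is taken with so small an exponent that the product of all its
-- factors Z has q-th power at most C b; only at the end is this compared with `r`.

private variable
  Elt Elt′ : Set
  Φ Ψ : Set

-- Indicator functions and finite sums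

χ : Dec Φ → ℕ
χ (yes _) = 1
χ (no _)  = 0

χ-yes : (d : Dec Φ) → Φ → χ d ≡ 1
χ-yes (yes _) _ = refl
χ-yes (no ¬p) p = ⊥-elim (¬p p)

χ-no : (d : Dec Φ) → ¬ Φ → χ d ≡ 0
χ-no (yes p) ¬p = ⊥-elim (¬p p)
χ-no (no _)  _  = refl

χ≤1 : (d : Dec Φ) → χ d ≤ 1
χ≤1 (yes _) = ≤-refl
χ≤1 (no _)  = z≤n

χ-elim : ∀ {m} (d : Dec Φ) → (Φ → 1 ≤ m) → χ d ≤ m
χ-elim (yes p) f = f p
χ-elim (no _)  _ = z≤n

χ-mono : (d : Dec Φ) (e : Dec Ψ) → (Φ → Ψ) → χ d ≤ χ e
χ-mono d e f = χ-elim d (λ p → ≤-reflexive (sym (χ-yes e (f p))))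

-- Opaque, so that unification never unfolds a sum over a concrete list such as intRange b.
opaque

  ∑ : List Elt → (Elt → ℕ) → ℕ
  ∑ []       f = 0
  ∑ (x ∷ xs) f = f x + ∑ xs f

  ∑-mono-∈ : (xs : List Elt) {f g : Elt → ℕ} → (∀ x → x ∈ xs → f x ≤ g x) → ∑ xs f ≤ ∑ xs g
  ∑-mono-∈ []       h = z≤n
  ∑-mono-∈ (x ∷ xs) h = +-mono-≤ (h x (here refl)) (∑-mono-∈ xs (λ y y∈ → h y (there y∈)))

  ∑-mono : (xs : List Elt) {f g : Elt → ℕ} → (∀ x → f x ≤ g x) → ∑ xs f ≤ ∑ xs g
  ∑-mono xs h = ∑-mono-∈ xs (λ x _ → h x)

  ∑-cong : (xs : List Elt) {f g : Elt → ℕ} → (∀ x → f x ≡ g x) → ∑ xs f ≡ ∑ xs g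
  ∑-cong []       h = refl
  ∑-cong (x ∷ xs) h = cong₂ _+_ (h x) (∑-cong xs h)

  ∑-const : (xs : List Elt) (c : ℕ) → ∑ xs (λ _ → c) ≡ length xs * c
  ∑-const []       c = refl
  ∑-const (x ∷ xs) c = cong (c ℕ.+_) (∑-const xs c)

  ∑-bound-∈ : (xs : List Elt) {f : Elt → ℕ} {c : ℕ} → (∀ x → x ∈ xs → f x ≤ c) → ∑ xs f ≤ length xs * c
  ∑-bound-∈ xs {c = c} h = ≤-trans (∑-mono-∈ xs h) (≤-reflexive (∑-const xs c))

  ∑-distrib-+ : (xs : List Elt) (f g : Elt → ℕ) → ∑ xs (λ x → f x + g x) ≡ ∑ xs f + ∑ xs g
  ∑-distrib-+ []       f g = refl
  ∑-distrib-+ (x ∷ xs) f g rewrite ∑-distrib-+ xs f g = interchange (f x) (g x) (∑ xs f) (∑ xs g)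
    where
    interchange : ∀ a b c d → (a + b) + (c + d) ≡ (a + c) + (b + d)
    interchange = solve-∀

  ∑-*ʳ : (xs : List Elt) (f : Elt → ℕ) (c : ℕ) → ∑ xs f * c ≡ ∑ xs (λ x → f x * c)
  ∑-*ʳ []       f c = refl
  ∑-*ʳ (x ∷ xs) f c = trans (*-distribʳ-+ c (f x) (∑ xs f)) (cong (f x * c ℕ.+_) (∑-*ʳ xs f c))

  ∑-*ˡ : (xs : List Elt) (f : Elt → ℕ) (c : ℕ) → c * ∑ xs f ≡ ∑ xs (λ x → c * f x)
  ∑-*ˡ []       f c = *-zeroʳ c
  ∑-*ˡ (x ∷ xs) f c = trans (*-distribˡ-+ c (f x) (∑ xs f)) (cong (c * f x ℕ.+_) (∑-*ˡ xs f c))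

  ∑-swap : (xs : List Elt) (ys : List Elt′) (f : Elt → Elt′ → ℕ) →
           ∑ xs (λ x → ∑ ys (f x)) ≡ ∑ ys (λ y → ∑ xs (λ x → f x y))
  ∑-swap []       ys f = sym (trans (∑-const ys 0) (*-zeroʳ (length ys)))
  ∑-swap (x ∷ xs) ys f =
    trans (cong (∑ ys (f x) ℕ.+_) (∑-swap xs ys f))
          (sym (∑-distrib-+ ys (f x) (λ y → ∑ xs (λ x → f x y))))

  ∑-++ : (xs ys : List Elt) (f : Elt → ℕ) → ∑ (xs ++ ys) f ≡ ∑ xs f + ∑ ys f
  ∑-++ []       ys f = refl
  ∑-++ (x ∷ xs) ys f = trans (cong (f x ℕ.+_) (∑-++ xs ys f)) (sym (+-assoc (f x) _ _))

  ∑-map : (h : Elt → Elt′) (xs : List Elt) (f : Elt′ → ℕ) → ∑ (map h xs) f ≡ ∑ xs (λ x → f (h x))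
  ∑-map h []       f = refl
  ∑-map h (x ∷ xs) f = cong (f (h x) ℕ.+_) (∑-map h xs f)

  ∑-concatMap : (h : Elt → List Elt′) (xs : List Elt) (f : Elt′ → ℕ) →
                ∑ (concatMap h xs) f ≡ ∑ xs (λ x → ∑ (h x) f)
  ∑-concatMap h []       f = refl
  ∑-concatMap h (x ∷ xs) f = trans (∑-++ (h x) _ f) (cong (∑ (h x) f ℕ.+_) (∑-concatMap h xs f))

  ∑-cartesianProduct : (xs : List Elt) (ys : List Elt′) (f : Elt × Elt′ → ℕ) →
                       ∑ (cartesianProduct xs ys) f ≡ ∑ xs (λ x → ∑ ys (λ y → f (x , y)))
  ∑-cartesianProduct []       ys f = refl
  ∑-cartesianProduct (x ∷ xs) ys f =
    trans (∑-++ (map (x ,_) ys) _ f)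
          (cong₂ _+_ (∑-map (x ,_) ys f) (∑-cartesianProduct xs ys f))

  length-filter≡∑ : {R : Elt → Set} (R? : Decidable R) (xs : List Elt) →
                    length (filter R? xs) ≡ ∑ xs (λ x → χ (R? x))
  length-filter≡∑ R? []       = refl
  length-filter≡∑ R? (x ∷ xs) with R? x
  ... | yes _ = cong suc (length-filter≡∑ R? xs)
  ... | no  _ = length-filter≡∑ R? xs

  term≤∑ : (xs : List Elt) (f : Elt → ℕ) {x : Elt} → x ∈ xs → f x ≤ ∑ xs f
  term≤∑ (x ∷ xs) f (here refl) = m≤m+n (f x) _
  term≤∑ (x ∷ xs) f (there x∈)  = ≤-trans (term≤∑ xs f x∈) (m≤n+m _ (f x))

  ∑χ≡0⊎∃ : {R : Elt → Set} (R? : Decidable R) (xs : List Elt) →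
            ∑ xs (λ x → χ (R? x)) ≡ 0 ⊎ ∃ λ x → x ∈ xs × R x
  ∑χ≡0⊎∃ R? []       = inj₁ refl
  ∑χ≡0⊎∃ R? (x ∷ xs) with R? x
  ... | yes r = inj₂ (x , here refl , r)
  ... | no  _ with ∑χ≡0⊎∃ R? xs
  ...   | inj₁ e             = inj₁ e
  ...   | inj₂ (y , y∈ , ry) = inj₂ (y , there y∈ , ry)

  ∑-[-] : (x : Elt) (f : Elt → ℕ) → ∑ (x ∷ []) f ≡ f x
  ∑-[-] x f = +-identityʳ (f x)

  ∑-applyUpTo-suc : (h : ℕ → Elt) (f : Elt → ℕ) (n : ℕ) →
                    ∑ (applyUpTo h (suc n)) f ≡ ∑ (applyUpTo h n) f + f (h n)
  ∑-applyUpTo-suc h f zero    = +-comm (f (h 0)) 0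
  ∑-applyUpTo-suc h f (suc n) = trans (cong (f (h 0) ℕ.+_) (∑-applyUpTo-suc (λ i → h (suc i)) f n))
                                      (sym (+-assoc (f (h 0)) _ _))

  ∑-upTo-zero : (f : ℕ → ℕ) → ∑ (upTo 0) f ≡ 0
  ∑-upTo-zero f = refl

  count-unique≤1 : (_≟_ : (x y : Elt) → Dec (x ≡ y)) {xs : List Elt} → Unique xs →
                   ∀ y → ∑ xs (λ x → χ (x ≟ y)) ≤ 1
  count-unique≤1 _≟_ {[]} [] y = z≤n
  count-unique≤1 _≟_ {x ∷ xs} (x∉ ∷ uniq) y with x ≟ y
  ... | no  _    = count-unique≤1 _≟_ uniq y
  ... | yes refl = s≤s (≤-reflexive (vanish xs x∉))
    where
    vanish : ∀ zs → ListAll.All (x ≢_) zs → ∑ zs (λ z → χ (z ≟ x)) ≡ 0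
    vanish []       ListAll.[]       = refl
    vanish (z ∷ zs) (x≢z ListAll.∷ a) = cong₂ _+_ (χ-no (z ≟ x) (λ e → x≢z (sym e))) (vanish zs a)

length≡∑1 : (xs : List Elt) → length xs ≡ ∑ xs (λ _ → 1)
length≡∑1 xs = sym (trans (∑-const xs 1) (*-identityʳ _))

-- Double counting of the equal pairs (x , y): every x occurs in at least one of them, every y in at
-- most one.
unique-⊆⇒length≤ : (_≟_ : (x y : Elt) → Dec (x ≡ y)) {xs ys : List Elt} → Unique xs →
                   (∀ x → x ∈ xs → x ∈ ys) → length xs ≤ length ys
unique-⊆⇒length≤ _≟_ {xs} {ys} uniq sub = begin
  length xs                                 ≡⟨ length≡∑1 xs ⟩
  ∑ xs (λ _ → 1)                            ≤⟨ ∑-mono-∈ xs (λ x x∈ →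
                                                 ≤-trans (≤-reflexive (sym (χ-yes (x ≟ x) refl)))
                                                         (term≤∑ ys (λ y → χ (x ≟ y)) (sub x x∈))) ⟩
  ∑ xs (λ x → ∑ ys (λ y → χ (x ≟ y)))       ≡⟨ ∑-swap xs ys _ ⟩
  ∑ ys (λ y → ∑ xs (λ x → χ (x ≟ y)))       ≤⟨ ∑-bound-∈ ys (λ y _ → count-unique≤1 _≟_ uniq y) ⟩
  length ys * 1                             ≡⟨ *-identityʳ _ ⟩
  length ys                                 ∎
  where open ≤-Reasoning

-- Counting well-spaced integers

module _ {R : ℕ → Set} (R? : Decidable R) {u L : ℕ}
         (spaced : ∀ {i j} → i < j → R i → R j → i + u ≤ j × j ≤ i + L) where

  private
    count : ℕ → ℕ
    count N = ∑ (upTo N) (λ i → χ (R? i))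

    -- The induction carries the first hit i and the last hit j: c hits leave c - 1 gaps of length
    -- at least u between them. The extra u on the right avoids the subtraction.
    extremes : ∀ N → count N ≡ 0 ⊎
               ∃ λ i → ∃ λ j → i ≤ j × j < N × R i × R j × i + count N * u ≤ j + u
    extremes zero    = inj₁ (∑-upTo-zero (λ i → χ (R? i)))
    extremes (suc N) with R? N | ∑-applyUpTo-suc (λ i → i) (λ i → χ (R? i)) N | extremes N
    ... | no _  | e | inj₁ z = inj₁ (trans e (trans (+-identityʳ _) z))
    ... | no _  | e | inj₂ (i , j , i≤j , j<N , ri , rj , le) =
      inj₂ (i , j , i≤j , m≤n⇒m≤1+n j<N , ri , rj ,
            subst (λ c → i + c * u ≤ j + u) (sym (trans e (+-identityʳ _))) le)
    ... | yes r | e | inj₁ z =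
      inj₂ (N , N , ≤-refl , ≤-refl , r , r ,
            ≤-reflexive (cong (N ℕ.+_) (trans (cong (_* u) (trans e (cong (_+ 1) z))) (*-identityˡ u))))
    ... | yes r | e | inj₂ (i , j , i≤j , j<N , ri , rj , le) =
      inj₂ (i , N , ≤-trans i≤j (<⇒≤ j<N) , ≤-refl , ri , r , (begin
        i + count (suc N) * u       ≡⟨ cong (λ c → i + c * u) e ⟩
        i + (count N + 1) * u       ≡⟨ rearr i (count N) u ⟩
        i + count N * u + u         ≤⟨ +-monoˡ-≤ u le ⟩
        j + u + u                   ≤⟨ +-monoˡ-≤ u (proj₁ (spaced j<N rj r)) ⟩
        N + u                       ∎))
      where
      open ≤-Reasoning
      rearr : ∀ i c u → i + (c + 1) * u ≡ i + c * u + u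
      rearr = solve-∀

  -- This is the estimate L / u + 1 for points at mutual distances between u and L, cleared of the
  -- denominator.
  spaced-upTo : ∀ N → ∑ (upTo N) (λ i → χ (R? i)) * u ≤ L + u
  spaced-upTo N with extremes N
  ... | inj₁ z rewrite z = z≤n
  ... | inj₂ (i , j , i≤j , _ , ri , rj , le) = +-cancelˡ-≤ i _ _ (begin
      i + count N * u ≤⟨ le ⟩
      j + u           ≤⟨ +-monoˡ-≤ u j≤i+L ⟩
      i + L + u       ≡⟨ +-assoc i L u ⟩
      i + (L + u)     ∎)
    where
    open ≤-Reasoning
    j≤i+L : j ≤ i + L
    j≤i+L with m≤n⇒m<n∨m≡n i≤j
    ... | inj₁ i<j  = proj₂ (spaced i<j ri rj)
    ... | inj₂ refl = m≤m+n i L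

-- The divisor bound

^-distribʳ-* : ∀ m n o → (m * n) ^ o ≡ m ^ o * n ^ o
^-distribʳ-* m n zero    = refl
^-distribʳ-* m n (suc o) = trans (cong (m * n *_) (^-distribʳ-* m n o)) (interchange m n (m ^ o) (n ^ o))
  where
  interchange : ∀ a b c d → a * b * (c * d) ≡ a * c * (b * d)
  interchange = solve-∀

^-cancelˡ-≤ : ∀ n .{{_ : NonZero n}} {m o} → m ^ n ≤ o ^ n → m ≤ o
^-cancelˡ-≤ n {m} {o} le = ≮⇒≥ (λ o<m → <⇒≱ (^-monoˡ-< n o<m) le)

m≤m^n : ∀ m n .{{_ : NonZero n}} → m ≤ m ^ n
m≤m^n zero    n       = z≤n
m≤m^n (suc m) (suc n) = m≤m*n (suc m) (suc m ^ n) {{m^n≢0 (suc m) n}}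

1+n≤2^n : ∀ n → suc n ≤ 2 ^ n
1+n≤2^n zero    = ≤-refl
1+n≤2^n (suc n) = begin
  1 + suc n         ≤⟨ +-mono-≤ (m^n>0 2 n) (1+n≤2^n n) ⟩
  2 ^ n + 2 ^ n     ≡⟨ cong (2 ^ n ℕ.+_) (sym (+-identityʳ _)) ⟩
  2 * 2 ^ n         ∎
  where open ≤-Reasoning

-- Division of a by q gives 1 + a ≤ q (a / q + 1) ≤ q 2^(a / q); the q-th power turns the last
-- factor into at most 2^a.
polynomial≤exponential : ∀ q .{{_ : NonZero q}} a → suc a ^ q ≤ q ^ q * 2 ^ a
polynomial≤exponential q a = begin
  suc a ^ q                 ≤⟨ ^-monoˡ-≤ q 1+a≤ ⟩
  (q * 2 ^ (a / q)) ^ q     ≡⟨ ^-distribʳ-* q (2 ^ (a / q)) q ⟩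
  q ^ q * (2 ^ (a / q)) ^ q ≡⟨ cong (q ^ q *_) (^-*-assoc 2 (a / q) q) ⟩
  q ^ q * 2 ^ (a / q * q)   ≤⟨ *-monoʳ-≤ (q ^ q) (^-monoʳ-≤ 2 (m/n*n≤m a q)) ⟩
  q ^ q * 2 ^ a             ∎
  where
  open ≤-Reasoning
  1+a≤ : suc a ≤ q * 2 ^ (a / q)
  1+a≤ = begin
    suc a                    ≡⟨ cong suc (m≡m%n+[m/n]*n a q) ⟩
    suc (a % q) + a / q * q  ≤⟨ +-monoˡ-≤ (a / q * q) (m%n<n a q) ⟩
    suc (a / q) * q          ≤⟨ *-monoˡ-≤ q (1+n≤2^n (a / q)) ⟩
    2 ^ (a / q) * q          ≡⟨ *-comm _ q ⟩
    q * 2 ^ (a / q)          ∎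

divisors : ℕ → List ℕ
divisors n = filter (ℕD._∣? n) (upTo (suc n))

τ : ℕ → ℕ
τ n = length (divisors n)

∈-divisors⁺ : ∀ {d n} .{{_ : NonZero n}} → d ℕD.∣ n → d ∈ divisors n
∈-divisors⁺ {n = n} d∣n = ∈-filter⁺ (ℕD._∣? n) (∈-upTo⁺ (s≤s (∣⇒≤ d∣n))) d∣n

∈-divisors⁻ : ∀ {d} n → d ∈ divisors n → d ℕD.∣ n
∈-divisors⁻ n d∈ = proj₂ (∈-filter⁻ (ℕD._∣? n) {xs = upTo (suc n)} d∈)

divisors-unique : ∀ n → Unique (divisors n)
divisors-unique n = filter⁺ (ℕD._∣? n) (upTo⁺ (suc n))

prime∧∤⇒coprime : ∀ {p d} → Prime p → p ℕD.∤ d → Coprime d p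
prime∧∤⇒coprime pr p∤d (i∣d , i∣p) with prime⇒irreducible pr i∣p
... | inj₁ i≡1  = i≡1
... | inj₂ refl = ⊥-elim (p∤d i∣d)

divisor-of-p^a*m : ∀ {p} → Prime p → ∀ a m d → d ℕD.∣ p ^ a * m →
                   ∃ λ i → ∃ λ e → i ≤ a × e ℕD.∣ m × d ≡ p ^ i * e
divisor-of-p^a*m pr zero m d d∣ =
  0 , d , z≤n , subst (d ℕD.∣_) (*-identityˡ m) d∣ , sym (*-identityˡ d)
divisor-of-p^a*m {p} pr (suc a) m d d∣ with p ℕD.∣? d
... | yes (ℕD.divides d′ refl) =
  let i , e , i≤a , e∣m , d′≡ = divisor-of-p^a*m pr a m d′ d′∣
  in suc i , e , s≤s i≤a , e∣m , trans (*-comm d′ p) (trans (cong (p *_) d′≡) (sym (*-assoc p (p ^ i) e)))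
  where
  instance _ = prime⇒nonZero pr
  d′∣ : d′ ℕD.∣ p ^ a * m
  d′∣ = ℕD.*-cancelˡ-∣ p (subst (ℕD._∣ p * (p ^ a * m)) (*-comm d′ p) (subst (d′ * p ℕD.∣_) (*-assoc p (p ^ a) m) d∣))
... | no p∤d =
  let i , e , i≤a , e∣m , d≡ = divisor-of-p^a*m pr a m d
                                 (coprime-divisor (prime∧∤⇒coprime pr p∤d) (subst (d ℕD.∣_) (*-assoc p (p ^ a) m) d∣))
  in i , e , m≤n⇒m≤1+n i≤a , e∣m , d≡

-- The list `products` may contain repetitions, for instance when p divides m. For an upper bound it
-- only has to cover the divisors.
τ[p^a*m]≤[1+a]*τ[m] : ∀ {p} → Prime p → ∀ a m .{{_ : NonZero m}} → τ (p ^ a * m) ≤ suc a * τ m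
τ[p^a*m]≤[1+a]*τ[m] {p} pr a m = begin
  τ (p ^ a * m)       ≤⟨ unique-⊆⇒length≤ _≟_ (divisors-unique (p ^ a * m)) sub ⟩
  length products     ≡⟨ length≡∑1 products ⟩
  ∑ products (λ _ → 1) ≡⟨ ∑-concatMap multiples (upTo (suc a)) _ ⟩
  ∑ (upTo (suc a)) (λ i → ∑ (multiples i) (λ _ → 1))
                      ≤⟨ ∑-bound-∈ (upTo (suc a)) (λ i _ → ≤-reflexive
                           (trans (sym (length≡∑1 (multiples i))) (length-map (p ^ i *_) (divisors m)))) ⟩
  length (upTo (suc a)) * τ m ≡⟨ cong (_* τ m) (length-upTo (suc a)) ⟩
  suc a * τ m         ∎
  where
  open ≤-Reasoning
  multiples : ℕ → List ℕ
  multiples i = map (p ^ i *_) (divisors m)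
  products : List ℕ
  products = concatMap multiples (upTo (suc a))
  sub : ∀ d → d ∈ divisors (p ^ a * m) → d ∈ products
  sub d d∈ with divisor-of-p^a*m pr a m d (∈-divisors⁻ (p ^ a * m) d∈)
  ... | i , e , i≤a , e∣m , refl =
    ∈-concatMap⁺ multiples (lose (∈-upTo⁺ (s≤s i≤a)) (∈-map⁺ (p ^ i *_) (∈-divisors⁺ e∣m)))


-- One sieve step: once all copies of c are removed, the remaining primes exceed c. The sieve runs
-- through all integers c, so the last component records that a c which is not prime has exponent 0.
extract-power : ∀ c ps → ListAll.All Prime ps → ListAll.All (c ≤_) ps →
                ∃ λ a → ∃ λ qs → ListAll.All Prime qs × ListAll.All (suc c ≤_) qs ×
                  product ps ≡ c ^ a * product qs × (a ≡ 0 ⊎ Prime c)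
extract-power c [] [] [] = 0 , [] , [] , [] , refl , inj₁ refl
extract-power c (p ∷ ps) (pr ∷ prs) (c≤p ∷ c≤ps) with extract-power c ps prs c≤ps | c ≟ p
... | a , qs , prs′ , c<qs , e , _ | yes refl =
  suc a , qs , prs′ , c<qs , trans (cong (c *_) e) (sym (*-assoc c (c ^ a) (product qs))) , inj₂ pr
... | a , qs , prs′ , c<qs , e , z | no c≢p =
  a , p ∷ qs , pr ∷ prs′ , ≤∧≢⇒< c≤p c≢p ∷ c<qs , trans (cong (p *_) e) (swap p (c ^ a) (product qs)) , z
  where
  swap : ∀ p x y → p * (x * y) ≡ x * (p * y)
  swap = solve-∀

-- Primes p ≥ 2 ^ q cost nothing, since τ (p m) ^ q ≤ 2 ^ q τ m ^ q; each of the boundedly many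
-- smaller primes costs a factor q ^ q.
τ-bound-primes≥ : ∀ q .{{_ : NonZero q}} b c ps → 2 ^ q ≤ c + b → ListAll.All Prime ps → ListAll.All (c ≤_) ps →
                  τ (product ps) ^ q ≤ (q ^ q) ^ b * product ps
τ-bound-primes≥ q zero c [] le [] [] = ≤-reflexive (^-zeroˡ q)
τ-bound-primes≥ q zero c (p ∷ ps) le (pr ∷ prs) (c≤p ∷ c≤ps) = begin
  τ (p * product ps) ^ q     ≡⟨ cong (λ x → τ (x * product ps) ^ q) (sym (^-identityʳ p)) ⟩
  τ (p ^ 1 * product ps) ^ q ≤⟨ ^-monoˡ-≤ q (τ[p^a*m]≤[1+a]*τ[m] pr 1 (product ps) {{productOfPrimes≢0 prs}}) ⟩
  (2 * τ (product ps)) ^ q   ≡⟨ ^-distribʳ-* 2 (τ (product ps)) q ⟩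
  2 ^ q * τ (product ps) ^ q ≤⟨ *-mono-≤ 2^q≤p (τ-bound-primes≥ q zero c ps le prs c≤ps) ⟩
  p * (1 * product ps)       ≡⟨ cong (p *_) (*-identityˡ (product ps)) ⟩
  p * product ps             ≡⟨ *-identityˡ _ ⟨
  1 * (p * product ps)       ∎
  where
  open ≤-Reasoning
  2^q≤p : 2 ^ q ≤ p
  2^q≤p = ≤-trans le (≤-trans (≤-reflexive (+-identityʳ c)) c≤p)
τ-bound-primes≥ q (suc b) c ps le prs c≤ps with extract-power c ps prs c≤ps
... | a , qs , prs′ , c<qs , e , z = begin
  τ (product ps) ^ q                    ≡⟨ cong (λ n → τ n ^ q) e ⟩
  τ (c ^ a * m) ^ q                     ≤⟨ ^-monoˡ-≤ q (τ-step z) ⟩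
  (suc a * τ m) ^ q                     ≡⟨ ^-distribʳ-* (suc a) (τ m) q ⟩
  suc a ^ q * τ m ^ q                   ≤⟨ *-mono-≤ (polynomial≤exponential q a)
                                             (τ-bound-primes≥ q b (suc c) qs (≤-trans le (≤-reflexive (+-suc c b))) prs′ c<qs) ⟩
  (q ^ q * 2 ^ a) * ((q ^ q) ^ b * m)   ≤⟨ *-monoˡ-≤ _ (*-monoʳ-≤ (q ^ q) (2^a≤c^a z)) ⟩
  (q ^ q * c ^ a) * ((q ^ q) ^ b * m)   ≡⟨ interchange (q ^ q) (c ^ a) ((q ^ q) ^ b) m ⟩
  (q ^ q) ^ suc b * (c ^ a * m)         ≡⟨ cong ((q ^ q) ^ suc b *_) e ⟨
  (q ^ q) ^ suc b * product ps          ∎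
  where
  open ≤-Reasoning
  m = product qs
  interchange : ∀ a b c d → a * b * (c * d) ≡ a * c * (b * d)
  interchange = solve-∀
  τ-step : a ≡ 0 ⊎ Prime c → τ (c ^ a * m) ≤ suc a * τ m
  τ-step (inj₁ refl) = ≤-reflexive (trans (cong τ (*-identityˡ m)) (sym (*-identityˡ (τ m))))
  τ-step (inj₂ pr)   = τ[p^a*m]≤[1+a]*τ[m] pr a m {{productOfPrimes≢0 prs′}}
  2^a≤c^a : a ≡ 0 ⊎ Prime c → 2 ^ a ≤ c ^ a
  2^a≤c^a (inj₁ refl) = ≤-refl
  2^a≤c^a (inj₂ pr)   = ^-monoˡ-≤ a (ℕ.nonTrivial⇒n>1 c {{prime⇒nonTrivial pr}})

-- The estimate τ(n) ≪ n^(1/q). The sieve starts at c = 0, so 2 ^ q values of c lie below the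
-- threshold, each costing a factor q ^ q; hence the constant.
τ-bound : ∀ q .{{_ : NonZero q}} → ∃ λ C → ∀ n .{{_ : NonZero n}} → τ n ^ q ≤ C * n
τ-bound q = (q ^ q) ^ (2 ^ q) , λ n →
  let open PrimeFactorisation (factorise n)
  in subst (λ m → τ m ^ q ≤ (q ^ q) ^ (2 ^ q) * m) (sym isFactorisation)
       (τ-bound-primes≥ q (2 ^ q) 0 factors ≤-refl factorsPrime (all≥0 factors))
  where
  all≥0 : ∀ ps → ListAll.All (0 ≤_) ps
  all≥0 []       = []
  all≥0 (p ∷ ps) = z≤n ∷ all≥0 ps

-- The substitute for real roots: it provides w of size g^(1/k) for a modulus g, and the bound Z for
-- the divisor function.
∃-floor-root : ∀ k .{{_ : NonZero k}} N → ∃ λ w → w ^ k ≤ N × N < suc w ^ k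
∃-floor-root (suc k) zero = 0 , z≤n , m^n>0 1 (suc k)
∃-floor-root (suc k) (suc N) with ∃-floor-root (suc k) N
... | w , le , lt with suc w ^ suc k ≤? suc N
...   | yes le′ = suc w , le′ , ≤-<-trans lt (^-monoˡ-< (suc k) (n<1+n (suc w)))
...   | no ≰    = w , m≤n⇒m≤1+n le , ≰⇒> ≰

-- Roots of monic polynomials modulo g

∣i-j∣≢0 : ∀ {x y} → x ≢ y → NonZero (abs (x ℤ.- y))
∣i-j∣≢0 {x} {y} x≢y = ℕ.≢-nonZero (λ e → x≢y (ℤP.i-j≡0⇒i≡j x y (ℤP.∣i∣≡0⇒i≡0 e)))

∣∧≢⇒≤ : ∀ {g x y} → + g ∣ x ℤ.- y → x ≢ y → g ≤ abs (x ℤ.- y)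
∣∧≢⇒≤ g∣ x≢y = ∣⇒≤ {{∣i-j∣≢0 x≢y}} (∣⇒∣ᵤ g∣)

∣⊖∣-≤-⊔ : ∀ {b} i → i ≤ 2 * b → abs (+ i ℤ.- + b) ≤ b
∣⊖∣-≤-⊔ {b} i i≤2b rewrite ℤP.[+m]-[+n]≡m⊖n i b with ≤-total i b
... | inj₁ i≤b rewrite ℤP.∣⊖∣-≤ i≤b = m∸n≤m b i
... | inj₂ b≤i rewrite ℤP.⊖-≥ b≤i = m≤n+o⇒m∸n≤o i b (subst (i ≤_) (cong (λ c → b + c) (+-identityʳ b)) i≤2b)

∈-intRange⇒∣x∣≤ : ∀ {b x} → x ∈ intRange b → abs x ≤ b
∈-intRange⇒∣x∣≤ {b} x∈ with ∈-map⁻ (λ i → (+ i) ℤ.- (+ b)) x∈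
... | i , i∈ , refl = ∣⊖∣-≤-⊔ i (≤-pred (∈-upTo⁻ i∈))

module _ {V : ℤ → Set} (V? : Decidable V) {u L : ℕ}
         (spaced : ∀ {x y} → V x → V y → x ≢ y → u ≤ abs (x ℤ.- y) × abs (x ℤ.- y) ≤ L) where

  -- With u = 1 and L = 0 the spacing condition says that V holds at most once; uniqueness arguments
  -- below are turned into counts in this way.
  spaced-intRange : ∀ b → ∑ (intRange b) (λ x → χ (V? x)) * u ≤ L + u
  spaced-intRange b = begin
    ∑ (intRange b) (λ x → χ (V? x)) * u          ≡⟨ cong (_* u) (∑-map shift (upTo (suc (2 * b))) (λ x → χ (V? x))) ⟩
    ∑ (upTo (suc (2 * b))) (λ i → χ (V? (shift i))) * u
      ≤⟨ spaced-upTo (λ i → V? (shift i)) spaced′ (suc (2 * b)) ⟩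
    L + u                                        ∎
    where
    open ≤-Reasoning
    shift : ℕ → ℤ
    shift i = (+ i) ℤ.- (+ b)
    telescope : ∀ i j k → (j ℤ.- k) ℤ.- (i ℤ.- k) ≡ j ℤ.- i
    telescope = ℤSolver.solve-∀
    distance : ∀ {i j} → i < j → abs (shift j ℤ.- shift i) ≡ j ∸ i
    distance {i} {j} i<j = trans (cong abs (trans (telescope (+ i) (+ j) (+ b))
                             (ℤP.[+m]-[+n]≡m⊖n j i))) (cong abs (ℤP.⊖-≥ (<⇒≤ i<j)))
    spaced′ : ∀ {i j} → i < j → V (shift i) → V (shift j) → i + u ≤ j × j ≤ i + L
    spaced′ {i} {j} i<j vi vj =
      let u≤ , ≤L = spaced vj vi (λ e → m<n⇒n≢0 (m<n⇒0<n∸m i<j) (trans (sym (distance i<j))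
                      (trans (cong (λ z → abs (z ℤ.- shift i)) e) (cong abs (ℤP.+-inverseʳ (shift i))))))
      in ≤-trans (+-monoʳ-≤ i (subst (u ≤_) (distance i<j) u≤)) (≤-reflexive (m+[n∸m]≡n (<⇒≤ i<j)))
       , ≤-trans (m≤n+m∸n j i) (+-monoʳ-≤ i (subst (_≤ L) (distance i<j) ≤L))

-- The vector c₀ ∷ … ∷ cₙ₋₁ encodes the monic polynomial xⁿ + cₙ₋₁ xⁿ⁻¹ + … + c₀.
evalMonic : ∀ {n} → Vec ℤ n → ℤ → ℤ
evalMonic []       x = + 1
evalMonic (c ∷ cs) x = c ℤ.+ x ℤ.* evalMonic cs x

-- Synthetic division: the coefficients of the quotient are the intermediate Horner values at z, and
-- the quotient is again monic.
monic-factor : ∀ {n} (f : Vec ℤ (suc n)) z → ∃ λ (q : Vec ℤ n) →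
               ∀ x → evalMonic f x ≡ (x ℤ.- z) ℤ.* evalMonic q x ℤ.+ evalMonic f z
monic-factor (c ∷ [])         z = [] , λ x → linear c x z
  where
  linear : ∀ c x z → c ℤ.+ x ℤ.* + 1 ≡ (x ℤ.- z) ℤ.* + 1 ℤ.+ (c ℤ.+ z ℤ.* + 1)
  linear = ℤSolver.solve-∀
monic-factor (c ∷ cs@(_ ∷ _)) z with monic-factor cs z
... | q , eq = evalMonic cs z ∷ q , λ x →
      trans (cong (λ v → c ℤ.+ x ℤ.* v) (eq x)) (step c x z (evalMonic q x) (evalMonic cs z))
  where
  step : ∀ c x z q f → c ℤ.+ x ℤ.* ((x ℤ.- z) ℤ.* q ℤ.+ f)
                     ≡ (x ℤ.- z) ℤ.* (f ℤ.+ x ℤ.* q) ℤ.+ (c ℤ.+ z ℤ.* f)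
  step = ℤSolver.solve-∀

-- Since g divides both q s and q g, it divides their gcd, which is q gcd (s , g). In this form
-- nothing has to be divided by the gcd.
∣gcd* : ∀ {g} s q → + g ∣ s ℤ.* q → + g ∣ + gcd (abs s) g ℤ.* q
∣gcd* {g} s q g∣sq = ∣ᵤ⇒∣ (subst (g ℕD.∣_) eq (gcd-greatest g∣qs (ℕD.n∣m*n (abs q))))
  where
  g∣qs : g ℕD.∣ abs q * abs s
  g∣qs = subst (g ℕD.∣_) (trans (ℤP.abs-* s q) (*-comm (abs s) (abs q))) (∣⇒∣ᵤ g∣sq)
  eq : gcd (abs q * abs s) (abs q * g) ≡ abs (+ gcd (abs s) g ℤ.* q)
  eq = trans (sym (c*gcd[m,n]≡gcd[cm,cn] (abs q) (abs s) g))
         (trans (*-comm (abs q) (gcd (abs s) g)) (sym (ℤP.abs-* (+ gcd (abs s) g) q)))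

-- With w about g^(1/n) for f of degree n: fix one root z; any root x satisfies
-- f x = (x - z) q x + f z, so u = gcd (x - z) g and g / u divide x - z and q x.  If u ≥ w the roots
-- with this u are sparse, otherwise w ^ (n - 1) ≤ g / u and the degree drops.
module _ {V : ℤ → Set} (V? : Decidable V) {L : ℕ}
         (window : ∀ {x y} → V x → V y → abs (x ℤ.- y) ≤ L)
         {N Z : ℕ} (τ≤Z : ∀ m .{{_ : NonZero m}} → m ≤ N → τ m ≤ Z) (1≤Z : 1 ≤ Z) (b : ℕ) where

  roots-bound : ∀ n (f : Vec ℤ (suc n)) g .{{_ : NonZero g}} → g ≤ N →
                ∀ w .{{_ : NonZero w}} → w ^ suc n ≤ g →
                ∑ (intRange b) (λ x → χ (V? x ×-dec (+ g ∣? evalMonic f x))) * w ≤ Z ^ n * (L + w)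
  roots-bound zero (c ∷ []) g g≤N w w≤g = ≤-trans
    (spaced-intRange (λ x → V? x ×-dec (+ g ∣? evalMonic (c ∷ []) x)) spaced b)
    (≤-reflexive (sym (*-identityˡ (L + w))))
    where
    difference : ∀ c x y → (c ℤ.+ x ℤ.* + 1) ℤ.- (c ℤ.+ y ℤ.* + 1) ≡ x ℤ.- y
    difference = ℤSolver.solve-∀
    spaced : ∀ {x y} → V x × + g ∣ evalMonic (c ∷ []) x → V y × + g ∣ evalMonic (c ∷ []) y →
             x ≢ y → w ≤ abs (x ℤ.- y) × abs (x ℤ.- y) ≤ L
    spaced {x} {y} (vx , gx) (vy , gy) x≢y =
      ≤-trans (≤-trans (≤-reflexive (sym (^-identityʳ w))) w≤g)
              (∣∧≢⇒≤ (subst (+ g ∣_) (difference c x y) (ℤD.∣m∣n⇒∣m-n gx gy)) x≢y)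
      , window vx vy
  roots-bound (suc n) f g g≤N w w^≤g
    with ∑χ≡0⊎∃ (λ x → V? x ×-dec (+ g ∣? evalMonic f x)) (intRange b)
  ... | inj₁ ∑≡0 rewrite ∑≡0 = z≤n
  ... | inj₂ (z , _ , vz , g∣fz) with monic-factor f z
  ...   | q , f≡ = begin
    ∑ I (λ x → χ (V? x ×-dec (+ g ∣? evalMonic f x))) * w
      ≤⟨ *-monoˡ-≤ w (∑-mono I (λ x → χ-elim (V? x ×-dec (+ g ∣? evalMonic f x)) (split x))) ⟩
    ∑ I (λ x → ∑ (divisors g) (λ u → χ (S? u x))) * w ≡⟨ cong (_* w) (∑-swap I (divisors g) _) ⟩
    ∑ (divisors g) (λ u → ∑ I (λ x → χ (S? u x))) * w ≡⟨ ∑-*ʳ (divisors g) _ w ⟩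
    ∑ (divisors g) (λ u → ∑ I (λ x → χ (S? u x)) * w)
      ≤⟨ ∑-bound-∈ (divisors g) (λ u u∈ → class-bound u (∈-divisors⁻ g u∈)) ⟩
    τ g * (Z ^ n * (L + w))      ≤⟨ *-monoˡ-≤ _ (τ≤Z g g≤N) ⟩
    Z * (Z ^ n * (L + w))        ≡⟨ *-assoc Z (Z ^ n) (L + w) ⟨
    Z ^ suc n * (L + w)          ∎
    where
    open ≤-Reasoning
    I = intRange b
    S : ℕ → ℤ → Set
    S u x = V x × (+ u ∣ x ℤ.- z × + g ∣ + u ℤ.* evalMonic q x)
    S? : ∀ u → Decidable (S u)
    S? u x = V? x ×-dec ((+ u ∣? x ℤ.- z) ×-dec (+ g ∣? + u ℤ.* evalMonic q x))
    split : ∀ x → V x × + g ∣ evalMonic f x → 1 ≤ ∑ (divisors g) (λ u → χ (S? u x))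
    split x (vx , g∣fx) = ≤-trans (≤-reflexive (sym (χ-yes (S? u x) (vx , u∣ , g∣uq))))
                                  (term≤∑ (divisors g) (λ u → χ (S? u x)) (∈-divisors⁺ (gcd[m,n]∣n (abs (x ℤ.- z)) g)))
      where
      u = gcd (abs (x ℤ.- z)) g
      u∣ : + u ∣ x ℤ.- z
      u∣ = ∣ᵤ⇒∣ (gcd[m,n]∣m (abs (x ℤ.- z)) g)
      g∣uq : + g ∣ + u ℤ.* evalMonic q x
      g∣uq = ∣gcd* (x ℤ.- z) (evalMonic q x) (ℤD.∣m+n∣n⇒∣m (subst (+ g ∣_) (f≡ x) g∣fx) g∣fz)
    class-bound : ∀ u → u ℕD.∣ g → ∑ I (λ x → χ (S? u x)) * w ≤ Z ^ n * (L + w)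
    class-bound u (ℕD.divides m g≡mu) with w ≤? u
    ... | yes w≤u = ≤-trans (spaced-intRange (S? u) spaced b) (m≤n*m (L + w) (Z ^ n) {{m^n≢0 Z n {{ℕ.>-nonZero 1≤Z}}}})
      where
      difference : ∀ x y z → (x ℤ.- z) ℤ.- (y ℤ.- z) ≡ x ℤ.- y
      difference = ℤSolver.solve-∀
      spaced : ∀ {x y} → S u x → S u y → x ≢ y → w ≤ abs (x ℤ.- y) × abs (x ℤ.- y) ≤ L
      spaced {x} {y} (vx , ux , _) (vy , uy , _) x≢y =
        ≤-trans w≤u (∣∧≢⇒≤ (subst (+ u ∣_) (difference x y z) (ℤD.∣m∣n⇒∣m-n ux uy)) x≢y) , window vx vy
    ... | no w≰u = ≤-trans
        (*-monoˡ-≤ w (∑-mono I (λ x → χ-mono (S? u x) (V? x ×-dec (+ m ∣? evalMonic q x))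
          (λ { (vx , _ , g∣uq) → vx , cancel x g∣uq }))))
        (roots-bound n q m m≤N w w^≤m)
      where
      g≢0 : g ≢ 0
      g≢0 = ℕ.≢-nonZero⁻¹ g
      instance
        u≢0 : NonZero u
        u≢0 = ℕ.≢-nonZero (λ e → g≢0 (trans g≡mu (trans (cong (m *_) e) (*-zeroʳ m))))
        m≢0 : NonZero m
        m≢0 = ℕ.≢-nonZero (λ e → g≢0 (trans g≡mu (cong (_* u) e)))
      m≤N : m ≤ N
      m≤N = ≤-trans (≤-trans (m≤m*n m u) (≤-reflexive (sym g≡mu))) g≤N
      w^≤m : w ^ suc n ≤ m
      w^≤m = *-cancelʳ-≤ (w ^ suc n) m u (begin
        w ^ suc n * u  ≤⟨ *-monoʳ-≤ (w ^ suc n) (<⇒≤ (≰⇒> w≰u)) ⟩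
        w ^ suc n * w  ≡⟨ *-comm (w ^ suc n) w ⟩
        w ^ suc (suc n) ≤⟨ w^≤g ⟩
        g              ≡⟨ g≡mu ⟩
        m * u          ∎)
      cancel : ∀ x → + g ∣ + u ℤ.* evalMonic q x → + m ∣ evalMonic q x
      cancel x g∣ = ℤD.*-cancelˡ-∣ (+ u) (subst (_∣ + u ℤ.* evalMonic q x)
        (trans (cong +_ g≡mu) (trans (ℤP.pos-* m u) (ℤP.*-comm (+ m) (+ u)))) g∣)

-- Solutions of the congruence D ∣ c + formSum k v

∑-vecs-suc : {X : Set} (xs : List X) (n : ℕ) (F : Vec X (suc n) → ℕ) →
             ∑ (vecs xs (suc n)) F ≡ ∑ xs (λ x → ∑ (vecs xs n) (λ v → F (x ∷ v)))
∑-vecs-suc xs n F = trans (∑-concatMap (λ x → map (x ∷_) (vecs xs n)) xs F)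
                          (∑-cong xs (λ x → ∑-map (x ∷_) (vecs xs n) F))

length-intRange : ∀ N → length (intRange N) ≡ suc (2 * N)
length-intRange N = trans (length-map (λ i → (+ i) ℤ.- (+ N)) (upTo (suc (2 * N)))) (length-upTo (suc (2 * N)))

-- The e of the overview: the distance from x to the nearer of y and -y. The plain distance |x - y|
-- would not do, because for even k the difference of the powers also vanishes at x = -y.
gap : ℤ × ℤ → ℕ
gap (x , y) = ℕ.∣ abs x - abs y ∣

powerDiff : ℕ → ℤ × ℤ → ℤ
powerDiff k (x , y) = (x ℤ.^ k) ℤ.- (y ℤ.^ k)

pairs : ℕ → List (ℤ × ℤ)
pairs b = cartesianProduct (intRange b) (intRange b)

triples : ℕ → ℕ → List Triple
triples A b = cartesianProduct (intRange A) (pairs b)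

abs-⊖ : ∀ m n → abs (m ℤ.⊖ n) ≡ ℕ.∣ m - n ∣
abs-⊖ zero    zero    = refl
abs-⊖ zero    (suc n) = refl
abs-⊖ (suc m) zero    = refl
abs-⊖ (suc m) (suc n) = trans (cong abs (ℤP.[1+m]⊖[1+n]≡m⊖n m n)) (abs-⊖ m n)

gap≡ : ∀ x y → abs (x ℤ.- y) ≡ gap (x , y) ⊎ abs (x ℤ.- (ℤ.- y)) ≡ gap (x , y)
gap≡ (+ m)    (+ n)    = inj₁ (trans (cong abs (ℤP.[+m]-[+n]≡m⊖n m n)) (abs-⊖ m n))
gap≡ (+ m)    -[1+ n ] = inj₂ (trans (cong abs (ℤP.[+m]-[+n]≡m⊖n m (suc n))) (abs-⊖ m (suc n)))
gap≡ -[1+ m ] (+ n)    = inj₂ (trans (cong (λ z → abs (-[1+ m ] ℤ.+ z)) (ℤP.neg-involutive (+ n)))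
                           (trans (abs-⊖ n (suc m)) (∣-∣-comm n (suc m))))
gap≡ -[1+ m ] -[1+ n ] = inj₁ (trans (abs-⊖ (suc n) (suc m)) (∣-∣-comm (suc n) (suc m)))

near-window : ∀ c {E x y} → abs (x ℤ.- c) ≤ E → abs (y ℤ.- c) ≤ E → abs (x ℤ.- y) ≤ 2 * E
near-window c {E} {x} {y} hx hy = begin
  abs (x ℤ.- y)                       ≡⟨ cong abs (recentre x y c) ⟩
  abs ((x ℤ.- c) ℤ.- (y ℤ.- c))       ≤⟨ ℤP.∣i-j∣≤∣i∣+∣j∣ (x ℤ.- c) (y ℤ.- c) ⟩
  abs (x ℤ.- c) + abs (y ℤ.- c)       ≤⟨ +-mono-≤ hx hy ⟩
  E + E                               ≡⟨ cong (λ e → E + e) (+-identityʳ E) ⟨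
  2 * E                               ∎
  where
  open ≤-Reasoning
  recentre : ∀ x y c → x ℤ.- y ≡ (x ℤ.- c) ℤ.- (y ℤ.- c)
  recentre = ℤSolver.solve-∀

evalMonic-replicate : ∀ n x → evalMonic (Vec.replicate n (+ 0)) x ≡ x ℤ.^ n
evalMonic-replicate zero    x = refl
evalMonic-replicate (suc n) x = trans (ℤP.+-identityˡ _) (cong (x ℤ.*_) (evalMonic-replicate n x))

NearPair : ℕ → ℕ → ℕ → ℤ × ℤ → Set
NearPair k g E p = gap p ≤ E × + g ∣ powerDiff k p

nearPair? : ∀ k g E → Decidable (NearPair k g E)
nearPair? k g E p = (gap p ≤? E) ×-dec (+ g ∣? powerDiff k p)

-- The N_g of the overview, with E in the place of e_i.
#near : (k b g E : ℕ) → ℕ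
#near k b g E = ∑ (pairs b) (λ p → χ (nearPair? k g E p))

-- Along a chain of moduli, each dividing the previous one, the counts of the earlier stages may all
-- be replaced by the count at the last modulus. A single maximum over g thus controls the whole
-- product.
#near-antitone : ∀ k b E {g h} → g ℕD.∣ h → #near k b h E ≤ #near k b g E
#near-antitone k b E {g} {h} g∣h = ∑-mono (pairs b) (λ p → χ-mono (nearPair? k h E p) (nearPair? k g E p)
  (λ { (gap≤E , h∣d) → gap≤E , ℤD.∣-trans (∣ᵤ⇒∣ g∣h) h∣d }))

module _ {N Z : ℕ} (τ≤Z : ∀ m .{{_ : NonZero m}} → m ≤ N → τ m ≤ Z) (1≤Z : 1 ≤ Z) where

  -- For fixed y the difference of the powers is monic in x of degree `suc k`, and a gap of at most
  -- E places x within E of y or of -y. The two windows, each of length 2 E, give the factor 2.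
  #near-bound : ∀ k b g .{{_ : NonZero g}} E → g ≤ N → ∀ w .{{_ : NonZero w}} → w ^ suc k ≤ g →
                #near (suc k) b g E * w ≤ suc (2 * b) * (2 * (Z ^ k * (2 * E + w)))
  #near-bound k b g E g≤N w w^≤g = begin
    ∑ (pairs b) (λ p → χ (nearPair? (suc k) g E p)) * w
      ≡⟨ cong (_* w) (trans (∑-cartesianProduct I I _) (∑-swap I I _)) ⟩
    ∑ I (λ y → ∑ I (λ x → χ (nearPair? (suc k) g E (x , y)))) * w
      ≡⟨ ∑-*ʳ I _ w ⟩
    ∑ I (λ y → ∑ I (λ x → χ (nearPair? (suc k) g E (x , y))) * w)
      ≤⟨ ∑-bound-∈ I (λ y _ → fibre y) ⟩
    length I * (2 * (Z ^ k * (2 * E + w)))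
      ≡⟨ cong (_* (2 * (Z ^ k * (2 * E + w)))) (length-intRange b) ⟩
    suc (2 * b) * (2 * (Z ^ k * (2 * E + w))) ∎
    where
    open ≤-Reasoning
    I = intRange b
    module _ (y : ℤ) where
      f : Vec ℤ (suc k)
      f = (ℤ.- (y ℤ.^ suc k)) ∷ Vec.replicate k (+ 0)
      f≡ : ∀ x → evalMonic f x ≡ powerDiff (suc k) (x , y)
      f≡ x = trans (cong (λ v → (ℤ.- (y ℤ.^ suc k)) ℤ.+ x ℤ.* v) (evalMonic-replicate k x))
                   (ℤP.+-comm (ℤ.- (y ℤ.^ suc k)) (x ℤ.^ suc k))
      close? : ∀ c → Decidable (λ x → abs (x ℤ.- c) ≤ E)
      close? c x = abs (x ℤ.- c) ≤? E
      root? : ∀ c x → Dec (abs (x ℤ.- c) ≤ E × + g ∣ evalMonic f x)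
      root? c x = close? c x ×-dec (+ g ∣? evalMonic f x)
      roots : ∀ c → ∑ I (λ x → χ (root? c x)) * w ≤ Z ^ k * (2 * E + w)
      roots c = roots-bound (close? c) (λ {x} {y} → near-window c {x = x} {y}) τ≤Z 1≤Z b k f g g≤N w w^≤g
      cover : ∀ x → NearPair (suc k) g E (x , y) → 1 ≤ χ (root? y x) + χ (root? (ℤ.- y) x)
      cover x (gap≤E , g∣d) with gap≡ x y
      ... | inj₁ e = ≤-trans (≤-reflexive (sym (χ-yes (root? y x)
                       (subst (_≤ E) (sym e) gap≤E , subst (+ g ∣_) (sym (f≡ x)) g∣d)))) (m≤m+n _ _)
      ... | inj₂ e = ≤-trans (≤-reflexive (sym (χ-yes (root? (ℤ.- y) x)
                       (subst (_≤ E) (sym e) gap≤E , subst (+ g ∣_) (sym (f≡ x)) g∣d)))) (m≤n+m _ _)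
      fibre : ∑ I (λ x → χ (nearPair? (suc k) g E (x , y))) * w ≤ 2 * (Z ^ k * (2 * E + w))
      fibre = begin
        ∑ I (λ x → χ (nearPair? (suc k) g E (x , y))) * w
          ≤⟨ *-monoˡ-≤ w (∑-mono I (λ x → χ-elim (nearPair? (suc k) g E (x , y)) (cover x))) ⟩
        ∑ I (λ x → χ (root? y x) + χ (root? (ℤ.- y) x)) * w
          ≡⟨ cong (_* w) (∑-distrib-+ I _ _) ⟩
        (∑ I (λ x → χ (root? y x)) + ∑ I (λ x → χ (root? (ℤ.- y) x))) * w
          ≡⟨ *-distribʳ-+ w (∑ I (λ x → χ (root? y x))) _ ⟩
        ∑ I (λ x → χ (root? y x)) * w + ∑ I (λ x → χ (root? (ℤ.- y) x)) * w
          ≤⟨ +-mono-≤ (roots y) (roots (ℤ.- y)) ⟩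
        Z ^ k * (2 * E + w) + Z ^ k * (2 * E + w)
          ≡⟨ cong (λ r → Z ^ k * (2 * E + w) + r) (+-identityʳ _) ⟨
        2 * (Z ^ k * (2 * E + w)) ∎

-- With h = gcd (d , D), two solutions a differ by a multiple of m = D / h, so there are at most 2 A
-- / m + 1 of them. The condition D ≤ A, hence m ≤ A, absorbs the + 1 and leaves 3 A h / D.
linear-congruence-count : ∀ A D .{{_ : NonZero D}} → D ≤ A → ∀ d s →
  ∑ (intRange A) (λ a → χ (+ D ∣? s ℤ.+ a ℤ.* d)) * D ≤ 3 * A * gcd (abs d) D
linear-congruence-count A D D≤A d s with gcd[m,n]∣n (abs d) D
... | ℕD.divides m D≡mh = begin
  ∑ I (λ a → χ (+ D ∣? s ℤ.+ a ℤ.* d)) * D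
    ≤⟨ *-monoˡ-≤ D (∑-mono-∈ I (λ a a∈ → χ-mono (+ D ∣? s ℤ.+ a ℤ.* d) (R? a) (∈-intRange⇒∣x∣≤ a∈ ,_))) ⟩
  ∑ I (λ a → χ (R? a)) * D            ≡⟨ cong (λ D → ∑ I (λ a → χ (R? a)) * D) D≡mh ⟩
  ∑ I (λ a → χ (R? a)) * (m * h)      ≡⟨ *-assoc (∑ I (λ a → χ (R? a))) m h ⟨
  ∑ I (λ a → χ (R? a)) * m * h        ≤⟨ *-monoˡ-≤ h (spaced-intRange R? spaced A) ⟩
  (2 * A + m) * h                     ≤⟨ *-monoˡ-≤ h (+-monoʳ-≤ (2 * A) (≤-trans m≤D D≤A)) ⟩
  (2 * A + A) * h                     ≡⟨ cong (_* h) (+-comm (2 * A) A) ⟩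
  3 * A * h                           ∎
  where
  open ≤-Reasoning
  I = intRange A
  h = gcd (abs d) D
  D≢0 : D ≢ 0
  D≢0 = ℕ.≢-nonZero⁻¹ D
  instance
    h≢0 : NonZero h
    h≢0 = ℕ.≢-nonZero (λ e → D≢0 (trans D≡mh (trans (cong (λ x → m * x) e) (*-zeroʳ m))))
  m≤D : m ≤ D
  m≤D = ≤-trans (m≤m*n m h) (≤-reflexive (sym D≡mh))
  R : ℤ → Set
  R a = abs a ≤ A × + D ∣ s ℤ.+ a ℤ.* d
  R? : Decidable R
  R? a = (abs a ≤? A) ×-dec (+ D ∣? s ℤ.+ a ℤ.* d)
  difference : ∀ s a b d → (s ℤ.+ a ℤ.* d) ℤ.- (s ℤ.+ b ℤ.* d) ≡ d ℤ.* (a ℤ.- b)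
  difference = ℤSolver.solve-∀
  spaced : ∀ {x y} → R x → R y → x ≢ y → m ≤ abs (x ℤ.- y) × abs (x ℤ.- y) ≤ 2 * A
  spaced {x} {y} (x≤A , dx) (y≤A , dy) x≢y =
    ∣∧≢⇒≤ (ℤD.*-cancelˡ-∣ (+ h) (subst (_∣ + h ℤ.* (x ℤ.- y)) D≡hm
            (∣gcd* d (x ℤ.- y) (subst (+ D ∣_) (difference s x y d) (ℤD.∣m∣n⇒∣m-n dx dy))))) x≢y
    , ≤-trans (ℤP.∣i-j∣≤∣i∣+∣j∣ x y) (≤-trans (+-mono-≤ x≤A y≤A)
        (≤-reflexive (cong (λ a → A + a) (sym (+-identityʳ A)))))
    where
    D≡hm : + D ≡ + h ℤ.* + m
    D≡hm = trans (cong +_ D≡mh) (trans (ℤP.pos-* m h) (ℤP.*-comm (+ m) (+ h)))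

module _ (k A b E : ℕ) where

  Near : Triple → Set
  Near (_ , p) = gap p ≤ E

  near? : Decidable Near
  near? (_ , p) = gap p ≤? E

  NearSol : ∀ {n} → ℕ → ℤ → Vec Triple n → Set
  NearSol D c v = All Near v × + D ∣ c ℤ.+ formSum k v

  nearSol? : ∀ {n} D c → Decidable (NearSol {n} D c)
  nearSol? D c v = All.all? near? v ×-dec (+ D ∣? c ℤ.+ formSum k v)

  #nearSol : ℕ → ℕ → ℤ → ℕ
  #nearSol n D c = ∑ (vecs (triples A b) n) (λ v → χ (nearSol? D c v))

  module _ {N Z : ℕ} (τ≤Z : ∀ m .{{_ : NonZero m}} → m ≤ N → τ m ≤ Z) (N≤A : N ≤ A) where

    -- Let h be the gcd of D with the power difference d of the first pair. The congruence modulo D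
    -- forces the congruence modulo h on the remaining triples, and then allows at most 3 A h / D
    -- values of the first coefficient. Grouping the pairs by h, and enlarging gcd equal to g to
    -- divisibility of d by g, gives the sum over divisors.
    #nearSol-step : ∀ n D .{{_ : NonZero D}} → D ≤ N → ∀ c →
      #nearSol (suc n) D c * D ≤ ∑ (divisors D) (λ g → #near k b g E * (#nearSol n g c * (3 * A * g)))
    #nearSol-step n D D≤N c = begin
      #nearSol (suc n) D c * D
        ≡⟨ cong (_* D) (∑-vecs-suc (triples A b) n _) ⟩
      ∑ (triples A b) (λ t → ∑ vs (λ v → χ (nearSol? D c (t ∷ v)))) * D
        ≡⟨ cong (_* D) (trans (∑-cartesianProduct (intRange A) (pairs b) _) (∑-swap (intRange A) (pairs b) _)) ⟩
      ∑ (pairs b) (λ p → ∑ (intRange A) (λ a → ∑ vs (λ v → χ (nearSol? D c ((a , p) ∷ v))))) * D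
        ≡⟨ ∑-*ʳ (pairs b) _ D ⟩
      ∑ (pairs b) (λ p → ∑ (intRange A) (λ a → ∑ vs (λ v → χ (nearSol? D c ((a , p) ∷ v)))) * D)
        ≤⟨ ∑-mono (pairs b) pair-bound ⟩
      ∑ (pairs b) (λ p → ∑ (divisors D) (λ g → χ (nearPair? k g E p) * weight g))
        ≡⟨ ∑-swap (pairs b) (divisors D) _ ⟩
      ∑ (divisors D) (λ g → ∑ (pairs b) (λ p → χ (nearPair? k g E p) * weight g))
        ≡⟨ ∑-cong (divisors D) (λ g → ∑-*ʳ (pairs b) (λ p → χ (nearPair? k g E p)) (weight g)) ⟨
      ∑ (divisors D) (λ g → #near k b g E * weight g) ∎
      where
      open ≤-Reasoning
      vs = vecs (triples A b) n
      weight : ℕ → ℕ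
      weight g = #nearSol n g c * (3 * A * g)
      module _ (p : ℤ × ℤ) where
        d = powerDiff k p
        h = gcd (abs d) D
        h∣d : + h ∣ d
        h∣d = ∣ᵤ⇒∣ (gcd[m,n]∣m (abs d) D)
        h∣D : + h ∣ + D
        h∣D = ∣ᵤ⇒∣ (gcd[m,n]∣n (abs d) D)
        regroup : ∀ c a d s → c ℤ.+ (a ℤ.* d ℤ.+ s) ≡ (c ℤ.+ s) ℤ.+ a ℤ.* d
        regroup = ℤSolver.solve-∀
        fibre : ∀ v → ∑ (intRange A) (λ a → χ (nearSol? D c ((a , p) ∷ v))) * D
                      ≤ χ (nearPair? k h E p) * (χ (nearSol? h c v) * (3 * A * h))
        -- A single admissible coefficient a suffices to read off the conditions on p and v; if
        -- there is none, the left side is 0.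
        fibre v with ∑χ≡0⊎∃ (λ a → nearSol? D c ((a , p) ∷ v)) (intRange A)
        ... | inj₁ ∑≡0 rewrite ∑≡0 = z≤n
        ... | inj₂ (a , _ , gap≤E ∷ nears , D∣) = begin
          ∑ (intRange A) (λ a → χ (nearSol? D c ((a , p) ∷ v))) * D
            ≤⟨ *-monoˡ-≤ D (∑-mono (intRange A) (λ a → χ-mono (nearSol? D c ((a , p) ∷ v))
                 (+ D ∣? (c ℤ.+ formSum k v) ℤ.+ a ℤ.* d)
                 (λ { (_ , D∣) → subst (+ D ∣_) (regroup c a d (formSum k v)) D∣ }))) ⟩
          ∑ (intRange A) (λ a → χ (+ D ∣? (c ℤ.+ formSum k v) ℤ.+ a ℤ.* d)) * D
            ≤⟨ linear-congruence-count A D (≤-trans D≤N N≤A) d (c ℤ.+ formSum k v) ⟩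
          3 * A * h
            ≡⟨ sym (trans (cong₂ (λ x y → x * (y * (3 * A * h)))
                 (χ-yes (nearPair? k h E p) (gap≤E , h∣d)) (χ-yes (nearSol? h c v) (nears , h∣s)))
                 (trans (*-identityˡ _) (*-identityˡ _))) ⟩
          χ (nearPair? k h E p) * (χ (nearSol? h c v) * (3 * A * h)) ∎
          where
          h∣s : + h ∣ c ℤ.+ formSum k v
          h∣s = ℤD.∣m+n∣n⇒∣m (ℤD.∣-trans h∣D (subst (+ D ∣_) (regroup c a d (formSum k v)) D∣)) (ℤD.∣n⇒∣m*n a h∣d)
        pair-bound : ∑ (intRange A) (λ a → ∑ vs (λ v → χ (nearSol? D c ((a , p) ∷ v)))) * D
                     ≤ ∑ (divisors D) (λ g → χ (nearPair? k g E p) * weight g)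
        pair-bound = begin
          ∑ (intRange A) (λ a → ∑ vs (λ v → χ (nearSol? D c ((a , p) ∷ v)))) * D
            ≡⟨ cong (_* D) (∑-swap (intRange A) vs _) ⟩
          ∑ vs (λ v → ∑ (intRange A) (λ a → χ (nearSol? D c ((a , p) ∷ v)))) * D
            ≡⟨ ∑-*ʳ vs _ D ⟩
          ∑ vs (λ v → ∑ (intRange A) (λ a → χ (nearSol? D c ((a , p) ∷ v))) * D)
            ≤⟨ ∑-mono vs fibre ⟩
          ∑ vs (λ v → χ (nearPair? k h E p) * (χ (nearSol? h c v) * (3 * A * h)))
            ≡⟨ ∑-*ˡ vs _ (χ (nearPair? k h E p)) ⟨
          χ (nearPair? k h E p) * ∑ vs (λ v → χ (nearSol? h c v) * (3 * A * h))
            ≡⟨ cong (χ (nearPair? k h E p) *_) (∑-*ʳ vs _ (3 * A * h)) ⟨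
          χ (nearPair? k h E p) * weight h
            ≤⟨ term≤∑ (divisors D) (λ g → χ (nearPair? k g E p) * weight g)
                 (∈-divisors⁺ (gcd[m,n]∣n (abs d) D)) ⟩
          ∑ (divisors D) (λ g → χ (nearPair? k g E p) * weight g) ∎

    -- κ carries the pair counts of the triples already removed.
    #nearSol-bound : ∀ n D .{{_ : NonZero D}} → D ≤ N → ∀ c κ M →
      (∀ g → g ℕD.∣ D → κ * (g * #near k b g E ^ n) ≤ M) →
      κ * (#nearSol n D c * D) ≤ (3 * A * Z) ^ n * M
    #nearSol-bound zero D D≤N c κ M hyp = begin
      κ * (#nearSol 0 D c * D)  ≤⟨ *-monoʳ-≤ κ (*-monoˡ-≤ D (≤-trans (≤-reflexive (∑-[-] [] _)) (χ≤1 (nearSol? D c [])))) ⟩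
      κ * (1 * D)               ≡⟨ cong (κ *_) (*-comm 1 D) ⟩
      κ * (D * 1)               ≤⟨ hyp D ℕD.∣-refl ⟩
      M                         ≡⟨ *-identityˡ M ⟨
      1 * M                     ∎
      where open ≤-Reasoning
    #nearSol-bound (suc n) D D≤N c κ M hyp = begin
      κ * (#nearSol (suc n) D c * D)
        ≤⟨ *-monoʳ-≤ κ (#nearSol-step n D D≤N c) ⟩
      κ * ∑ (divisors D) (λ g → #near k b g E * (#nearSol n g c * (3 * A * g)))
        ≡⟨ ∑-*ˡ (divisors D) _ κ ⟩
      ∑ (divisors D) (λ g → κ * (#near k b g E * (#nearSol n g c * (3 * A * g))))
        ≤⟨ ∑-bound-∈ (divisors D) (λ g g∈ → term g (∈-divisors⁻ D g∈)) ⟩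
      τ D * (3 * A * ((3 * A * Z) ^ n * M))
        ≤⟨ *-monoˡ-≤ _ (τ≤Z D D≤N) ⟩
      Z * (3 * A * ((3 * A * Z) ^ n * M))
        ≡⟨ assemble Z (3 * A) ((3 * A * Z) ^ n) M ⟩
      (3 * A * Z) ^ suc n * M ∎
      where
      open ≤-Reasoning
      assemble : ∀ z a p m → z * (a * (p * m)) ≡ a * z * p * m
      assemble = solve-∀
      regroup : ∀ κ x w a g → κ * (x * (w * (a * g))) ≡ a * (κ * x * (w * g))
      regroup = solve-∀
      absorb : ∀ κ x g p → κ * x * (g * p) ≡ κ * (g * (x * p))
      absorb = solve-∀
      term : ∀ g → g ℕD.∣ D → κ * (#near k b g E * (#nearSol n g c * (3 * A * g)))
                              ≤ 3 * A * ((3 * A * Z) ^ n * M)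
      term g g∣D@(ℕD.divides m D≡mg) = begin
        κ * (#near k b g E * (#nearSol n g c * (3 * A * g)))
          ≡⟨ regroup κ (#near k b g E) (#nearSol n g c) (3 * A) g ⟩
        3 * A * (κ * #near k b g E * (#nearSol n g c * g))
          ≤⟨ *-monoʳ-≤ (3 * A) (#nearSol-bound n g (≤-trans (∣⇒≤ g∣D) D≤N) c (κ * #near k b g E) M hyp′) ⟩
        3 * A * ((3 * A * Z) ^ n * M) ∎
        where
        instance
          g≢0 : NonZero g
          g≢0 = ℕ.≢-nonZero (λ e → ℕ.≢-nonZero⁻¹ D (trans D≡mg (trans (cong (λ x → m * x) e) (*-zeroʳ m))))
        hyp′ : ∀ f → f ℕD.∣ g → κ * #near k b g E * (f * #near k b f E ^ n) ≤ M
        hyp′ f f∣g = begin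
          κ * #near k b g E * (f * #near k b f E ^ n)
            ≤⟨ *-monoˡ-≤ (f * #near k b f E ^ n) (*-monoʳ-≤ κ (#near-antitone k b E f∣g)) ⟩
          κ * #near k b f E * (f * #near k b f E ^ n)
            ≡⟨ absorb κ (#near k b f E) f (#near k b f E ^ n) ⟩
          κ * (f * #near k b f E ^ suc n)
            ≤⟨ hyp f (ℕD.∣-trans f∣g g∣D) ⟩
          M ∎

-- Splitting off the steepest triple

abs-^ : ∀ x k → abs (x ℤ.^ k) ≡ abs x ^ k
abs-^ x zero    = refl
abs-^ x (suc k) = trans (ℤP.abs-* x (x ℤ.^ k)) (cong (abs x *_) (abs-^ x k))

^-superadditive : ∀ k .{{_ : NonZero k}} m n → m ^ k + n ^ k ≤ (m + n) ^ k
^-superadditive (suc zero)      m n = ≤-reflexive (sym (*-distribʳ-+ 1 m n))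
^-superadditive (suc k@(suc _)) m n = begin
  m * m ^ k + n * n ^ k             ≤⟨ +-mono-≤ (*-monoʳ-≤ m (m≤m+n (m ^ k) (n ^ k))) (*-monoʳ-≤ n (m≤n+m (n ^ k) (m ^ k))) ⟩
  m * (m ^ k + n ^ k) + n * (m ^ k + n ^ k) ≡⟨ *-distribʳ-+ (m ^ k + n ^ k) m n ⟨
  (m + n) * (m ^ k + n ^ k)         ≤⟨ *-monoʳ-≤ (m + n) (^-superadditive k m n) ⟩
  (m + n) * (m + n) ^ k             ∎
  where open ≤-Reasoning

∣m-n∣≤o : ∀ m n {o} → m ≤ n + o → n ≤ m + o → ℕ.∣ m - n ∣ ≤ o
∣m-n∣≤o m n le ge with ∣m-n∣≡[m∸n]∨[n∸m] m n
... | inj₁ e rewrite e = m≤n+o⇒m∸n≤o m n le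
... | inj₂ e rewrite e = m≤n+o⇒m∸n≤o n m ge

[n∸m]^k≤n^k∸m^k : ∀ k .{{_ : NonZero k}} {m n} → m ≤ n → (n ∸ m) ^ k ≤ n ^ k ∸ m ^ k
[n∸m]^k≤n^k∸m^k k {m} {n} m≤n = m+n≤o⇒m≤o∸n ((n ∸ m) ^ k) (begin
  (n ∸ m) ^ k + m ^ k    ≤⟨ ^-superadditive k (n ∸ m) m ⟩
  (n ∸ m + m) ^ k        ≡⟨ cong (_^ k) (m∸n+n≡m m≤n) ⟩
  n ^ k                  ∎)
  where open ≤-Reasoning

∣m-n∣^k≤∣m^k-n^k∣ : ∀ k .{{_ : NonZero k}} m n → ℕ.∣ m - n ∣ ^ k ≤ ℕ.∣ m ^ k - n ^ k ∣
∣m-n∣^k≤∣m^k-n^k∣ k m n with ≤-total m n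
... | inj₁ m≤n rewrite m≤n⇒∣m-n∣≡n∸m m≤n | m≤n⇒∣m-n∣≡n∸m (^-monoˡ-≤ k m≤n) = [n∸m]^k≤n^k∸m^k k m≤n
... | inj₂ n≤m rewrite m≤n⇒∣n-m∣≡n∸m n≤m | m≤n⇒∣n-m∣≡n∸m (^-monoˡ-≤ k n≤m) = [n∸m]^k≤n^k∸m^k k n≤m

gap≤∣x-y∣ : ∀ x y → gap (x , y) ≤ abs (x ℤ.- y)
gap≤∣x-y∣ x y = ∣m-n∣≤o (abs x) (abs y)
  (subst (λ z → abs z ≤ abs y + abs (x ℤ.- y)) (y+[x-y] x y) (ℤP.∣i+j∣≤∣i∣+∣j∣ y (x ℤ.- y)))
  (subst (λ z → abs z ≤ abs x + abs (x ℤ.- y)) (x-[x-y] x y) (ℤP.∣i-j∣≤∣i∣+∣j∣ x (x ℤ.- y)))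
  where
  y+[x-y] : ∀ x y → y ℤ.+ (x ℤ.- y) ≡ x
  y+[x-y] = ℤSolver.solve-∀
  x-[x-y] : ∀ x y → x ℤ.- (x ℤ.- y) ≡ y
  x-[x-y] = ℤSolver.solve-∀

-- Superadditivity of k-th powers, applied to n = (n - m) + m. Besides its role in the final
-- estimate, it shows that a positive gap makes the power difference nonzero, hence usable as a
-- modulus.
gap^k≤∣powerDiff∣ : ∀ k .{{_ : NonZero k}} p → gap p ^ k ≤ abs (powerDiff k p)
gap^k≤∣powerDiff∣ k (x , y) = begin
  gap (x , y) ^ k                  ≤⟨ ∣m-n∣^k≤∣m^k-n^k∣ k (abs x) (abs y) ⟩
  ℕ.∣ abs x ^ k - abs y ^ k ∣      ≡⟨ cong₂ ℕ.∣_-_∣ (abs-^ x k) (abs-^ y k) ⟨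
  gap (x ℤ.^ k , y ℤ.^ k)          ≤⟨ gap≤∣x-y∣ (x ℤ.^ k) (y ℤ.^ k) ⟩
  abs (powerDiff k (x , y))        ∎
  where open ≤-Reasoning

module _ {b} {p : ℤ × ℤ} (p∈ : p ∈ pairs b) where

  private
    x y : ℤ
    x = proj₁ p
    y = proj₂ p
    ∣x∣≤b : abs x ≤ b
    ∣x∣≤b = ∈-intRange⇒∣x∣≤ (proj₁ (∈-cartesianProduct⁻ (intRange b) (intRange b) p∈))
    ∣y∣≤b : abs y ≤ b
    ∣y∣≤b = ∈-intRange⇒∣x∣≤ (proj₂ (∈-cartesianProduct⁻ (intRange b) (intRange b) p∈))

  ∈-pairs⇒gap≤ : gap p ≤ b
  ∈-pairs⇒gap≤ = ≤-trans (∣m-n∣≤m⊔n (abs x) (abs y)) (⊔-lub ∣x∣≤b ∣y∣≤b)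

  ∈-pairs⇒∣powerDiff∣≤ : ∀ k → abs (powerDiff k p) ≤ 2 * b ^ k
  ∈-pairs⇒∣powerDiff∣≤ k = begin
    abs (powerDiff k p)                   ≤⟨ ℤP.∣i-j∣≤∣i∣+∣j∣ (x ℤ.^ k) (y ℤ.^ k) ⟩
    abs (x ℤ.^ k) + abs (y ℤ.^ k)         ≡⟨ cong₂ _+_ (abs-^ x k) (abs-^ y k) ⟩
    abs x ^ k + abs y ^ k                 ≤⟨ +-mono-≤ (^-monoˡ-≤ k ∣x∣≤b) (^-monoˡ-≤ k ∣y∣≤b) ⟩
    b ^ k + b ^ k                         ≡⟨ cong (λ e → b ^ k + e) (+-identityʳ _) ⟨
    2 * b ^ k                             ∎
    where open ≤-Reasoning

gap-zero-count : ∀ b x → ∑ (intRange b) (λ y → χ (gap (x , y) ≟ 0)) ≤ 2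
gap-zero-count b x = begin
  ∑ I (λ y → χ (gap (x , y) ≟ 0))                   ≤⟨ ∑-mono I (λ y → χ-elim (gap (x , y) ≟ 0) (cover y)) ⟩
  ∑ I (λ y → χ (y ℤP.≟ x) + χ (y ℤP.≟ ℤ.- x))       ≡⟨ ∑-distrib-+ I _ _ ⟩
  ∑ I (λ y → χ (y ℤP.≟ x)) + ∑ I (λ y → χ (y ℤP.≟ ℤ.- x)) ≤⟨ +-mono-≤ (once x) (once (ℤ.- x)) ⟩
  2                                                 ∎
  where
  open ≤-Reasoning
  I = intRange b
  cover : ∀ y → gap (x , y) ≡ 0 → 1 ≤ χ (y ℤP.≟ x) + χ (y ℤP.≟ ℤ.- x)
  cover y gap≡0 with gap≡ x y
  ... | inj₁ e = ≤-trans (≤-reflexive (sym (χ-yes (y ℤP.≟ x)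
                   (sym (ℤP.i-j≡0⇒i≡j x y (ℤP.∣i∣≡0⇒i≡0 (trans e gap≡0))))))) (m≤m+n _ _)
  ... | inj₂ e = ≤-trans (≤-reflexive (sym (χ-yes (y ℤP.≟ ℤ.- x)
                   (trans (sym (ℤP.neg-involutive y))
                     (cong ℤ.-_ (sym (ℤP.i-j≡0⇒i≡j x (ℤ.- y) (ℤP.∣i∣≡0⇒i≡0 (trans e gap≡0))))))))) (m≤n+m _ _)
  once : ∀ c → ∑ I (λ y → χ (y ℤP.≟ c)) ≤ 1
  once c = ≤-trans (≤-reflexive (sym (*-identityʳ _)))
    (spaced-intRange (λ y → y ℤP.≟ c) {u = 1} {L = 0} (λ { refl refl c≢c → ⊥-elim (c≢c refl) }) b)

∑-vecs-All : {X : Set} {P : X → Set} (P? : Decidable P) (xs : List X) (n : ℕ) →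
             ∑ (vecs xs n) (λ v → χ (All.all? P? v)) ≤ ∑ xs (λ x → χ (P? x)) ^ n
∑-vecs-All P? xs zero    = ≤-reflexive (∑-[-] [] _)
∑-vecs-All P? xs (suc n) = begin
  ∑ (vecs xs (suc n)) (λ v → χ (All.all? P? v))
    ≡⟨ ∑-vecs-suc xs n _ ⟩
  ∑ xs (λ x → ∑ (vecs xs n) (λ v → χ (All.all? P? (x ∷ v))))
    ≤⟨ ∑-mono xs (λ x → ∑-mono (vecs xs n) (λ v → χ-elim (All.all? P? (x ∷ v))
         (λ { (px ∷ pv) → ≤-reflexive (sym (cong₂ _*_ (χ-yes (P? x) px) (χ-yes (All.all? P? v) pv))) }))) ⟩
  ∑ xs (λ x → ∑ (vecs xs n) (λ v → χ (P? x) * χ (All.all? P? v)))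
    ≡⟨ ∑-cong xs (λ x → ∑-*ˡ (vecs xs n) _ (χ (P? x))) ⟨
  ∑ xs (λ x → χ (P? x) * ∑ (vecs xs n) (λ v → χ (All.all? P? v)))
    ≡⟨ ∑-*ʳ xs _ _ ⟨
  ∑ xs (λ x → χ (P? x)) * ∑ (vecs xs n) (λ v → χ (All.all? P? v))
    ≤⟨ *-monoʳ-≤ (∑ xs (λ x → χ (P? x))) (∑-vecs-All P? xs n) ⟩
  ∑ xs (λ x → χ (P? x)) ^ suc n ∎
  where open ≤-Reasoning

∑-vecs-≤1 : {X : Set} (xs : List X) (n : ℕ) {F : Vec X n → ℕ} → (∀ v → F v ≤ 1) → ∑ (vecs xs n) F ≤ length xs ^ n
∑-vecs-≤1 xs zero    F≤1 = ≤-trans (≤-reflexive (∑-[-] [] _)) (F≤1 [])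
∑-vecs-≤1 xs (suc n) F≤1 = ≤-trans (≤-reflexive (∑-vecs-suc xs n _))
  (∑-bound-∈ xs (λ x _ → ∑-vecs-≤1 xs n (λ v → F≤1 (x ∷ v))))

-- Separating position i from the rest merely permutes the terms. In the successor case the head y
-- is moved past the selected entry x by exchanging two sums.
∑-vecs-removeAt : {X : Set} (xs : List X) {n : ℕ} (i : Fin (suc n)) (F : X → Vec X n → ℕ) →
                  ∑ (vecs xs (suc n)) (λ v → F (lookup v i) (removeAt v i)) ≡ ∑ xs (λ x → ∑ (vecs xs n) (F x))
∑-vecs-removeAt xs {n}     zero    F = ∑-vecs-suc xs n _
∑-vecs-removeAt {X} xs {suc n} (suc i) F = begin
  ∑ (vecs xs (suc (suc n))) (λ v → F (lookup v (suc i)) (removeAt v (suc i)))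
    ≡⟨ ∑-vecs-suc xs (suc n) _ ⟩
  ∑ xs (λ y → ∑ (vecs xs (suc n)) (λ v → F (lookup v i) (removeAt (y ∷ v) (suc i))))
    ≡⟨ ∑-cong xs (λ y → ∑-cong (vecs xs (suc n)) (λ v → cong (F (lookup v i)) (removeAt-suc y v i))) ⟩
  ∑ xs (λ y → ∑ (vecs xs (suc n)) (λ v → F (lookup v i) (y ∷ removeAt v i)))
    ≡⟨ ∑-cong xs (λ y → ∑-vecs-removeAt xs i (λ x v → F x (y ∷ v))) ⟩
  ∑ xs (λ y → ∑ xs (λ x → ∑ (vecs xs n) (λ v → F x (y ∷ v))))
    ≡⟨ ∑-swap xs xs _ ⟩
  ∑ xs (λ x → ∑ xs (λ y → ∑ (vecs xs n) (λ v → F x (y ∷ v))))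
    ≡⟨ ∑-cong xs (λ x → ∑-vecs-suc xs n (F x)) ⟨
  ∑ xs (λ x → ∑ (vecs xs (suc n)) (F x)) ∎
  where
  open ≡-Reasoning
  removeAt-suc : ∀ {n} (y : X) (v : Vec X (suc n)) i → removeAt (y ∷ v) (suc i) ≡ y ∷ removeAt v i
  removeAt-suc y (_ ∷ _) i = refl

All-removeAt : {X : Set} {P : X → Set} {n : ℕ} {v : Vec X (suc n)} (i : Fin (suc n)) → All P v → All P (removeAt v i)
All-removeAt zero    (_ ∷ ps)           = ps
All-removeAt (suc i) (p ∷ ps@(_ ∷ _)) = p ∷ All-removeAt i ps

argmax : {X : Set} (f : X → ℕ) {n : ℕ} (v : Vec X (suc n)) → ∃ λ i → All (λ x → f x ≤ f (lookup v i)) v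
argmax f (x ∷ [])         = zero , ≤-refl ∷ []
argmax f (x ∷ v@(_ ∷ _)) with argmax f v
... | i , maxᵢ with ≤-total (f x) (f (lookup v i))
...   | inj₁ le = suc i , le ∷ maxᵢ
...   | inj₂ ge = zero , ≤-refl ∷ All.map (λ le → ≤-trans le ge) maxᵢ

term : ℕ → Triple → ℤ
term k (a , p) = a ℤ.* powerDiff k p

formSum-removeAt : ∀ k {n} (v : Vec Triple (suc n)) i → formSum k v ≡ term k (lookup v i) ℤ.+ formSum k (removeAt v i)
formSum-removeAt k (t ∷ v)            zero    = refl
formSum-removeAt k (t ∷ v@(_ ∷ _)) (suc i) =
  trans (cong (λ s → term k t ℤ.+ s) (formSum-removeAt k v i))
        (swap (term k t) (term k (lookup v i)) (formSum k (removeAt v i)))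
  where
  swap : ∀ a b c → a ℤ.+ (b ℤ.+ c) ≡ b ℤ.+ (a ℤ.+ c)
  swap = ℤSolver.solve-∀

#zeros : (k n A b : ℕ) → ℕ
#zeros k n A b = ∑ (vecs (triples A b) n) (λ v → χ (formSum k v ℤP.≟ + 0))

length-pairs : ∀ b → length (pairs b) ≡ suc (2 * b) * suc (2 * b)
length-pairs b = begin
  length (pairs b)                                    ≡⟨ length≡∑1 (pairs b) ⟩
  ∑ (pairs b) (λ _ → 1)                               ≡⟨ ∑-cartesianProduct (intRange b) (intRange b) _ ⟩
  ∑ (intRange b) (λ _ → ∑ (intRange b) (λ _ → 1))     ≡⟨ ∑-const (intRange b) _ ⟩
  length (intRange b) * ∑ (intRange b) (λ _ → 1)      ≡⟨ cong (length (intRange b) *_) (length≡∑1 (intRange b)) ⟨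
  length (intRange b) * length (intRange b)           ≡⟨ cong₂ _*_ (length-intRange b) (length-intRange b) ⟩
  suc (2 * b) * suc (2 * b)                           ∎
  where open ≡-Reasoning

module _ (k : ℕ) .{{_ : NonZero k}} (A b n K : ℕ)
         (nearSol≤K : ∀ p → p ∈ pairs b → 0 < gap p → #nearSol k A b (gap p) n (abs (powerDiff k p)) (+ 0) ≤ K) where

  private
    T = triples A b
    Flat? : (t : Triple) → Dec (gap (proj₂ t) ≡ 0)
    Flat? t = gap (proj₂ t) ≟ 0
    Steepest : Triple → Vec Triple n → Set
    Steepest t v = 0 < gap (proj₂ t) × All (Near k A b (gap (proj₂ t))) v × term k t ℤ.+ formSum k v ≡ + 0
    steepest? : ∀ t v → Dec (Steepest t v)
    steepest? t v = (0 <? gap (proj₂ t)) ×-dec (All.all? (near? k A b (gap (proj₂ t))) v ×-dec (term k t ℤ.+ formSum k v ℤP.≟ + 0))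

    cover : ∀ v → formSum k v ≡ + 0 →
            1 ≤ χ (All.all? Flat? v) + ∑ (allFin (suc n)) (λ i → χ (steepest? (lookup v i) (removeAt v i)))
    cover v sum≡0 with argmax (λ t → gap (proj₂ t)) v
    ... | i , maxᵢ with 0 <? gap (proj₂ (lookup v i))
    ...   | yes 0<gap = ≤-trans (≤-trans
              (≤-reflexive (sym (χ-yes (steepest? (lookup v i) (removeAt v i))
                (0<gap , All-removeAt i maxᵢ , trans (sym (formSum-removeAt k v i)) sum≡0))))
              (term≤∑ (allFin (suc n)) _ (∈-allFin i))) (m≤n+m _ _)
    ...   | no ¬0<gap = ≤-trans (≤-reflexive (sym (χ-yes (All.all? Flat? v)
              (All.map (λ le → n≤0⇒n≡0 (≤-trans le (≮⇒≥ ¬0<gap))) maxᵢ)))) (m≤m+n _ _)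

    flat-count : ∑ T (λ t → χ (Flat? t)) ≤ suc (2 * A) * (suc (2 * b) * 2)
    flat-count = begin
      ∑ T (λ t → χ (Flat? t))
        ≡⟨ ∑-cartesianProduct (intRange A) (pairs b) _ ⟩
      ∑ (intRange A) (λ a → ∑ (pairs b) (λ p → χ (gap p ≟ 0)))
        ≤⟨ ∑-bound-∈ (intRange A) (λ _ _ → ≤-trans (≤-reflexive (∑-cartesianProduct (intRange b) (intRange b) _))
             (∑-bound-∈ (intRange b) (λ x _ → gap-zero-count b x))) ⟩
      length (intRange A) * (length (intRange b) * 2)
        ≡⟨ cong₂ (λ l m → l * (m * 2)) (length-intRange A) (length-intRange b) ⟩
      suc (2 * A) * (suc (2 * b) * 2) ∎
      where open ≤-Reasoning

    module _ (p : ℤ × ℤ) (p∈ : p ∈ pairs b) where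
      d = powerDiff k p
      D = abs d

      -- With d ≠ 0 the equation a d + s = 0 has at most one solution a, and the existence of one
      -- shows that |d| divides s.
      coefficient-count : 0 < gap p → ∀ v →
        ∑ (intRange A) (λ a → χ (steepest? (a , p) v)) ≤ χ (nearSol? k A b (gap p) D (+ 0) v)
      coefficient-count 0<gap v with ∑χ≡0⊎∃ (λ a → steepest? (a , p) v) (intRange A)
      ... | inj₁ ∑≡0 rewrite ∑≡0 = z≤n
      ... | inj₂ (a , _ , _ , nears , sum≡0) = begin
        ∑ (intRange A) (λ a → χ (steepest? (a , p) v))      ≡⟨ *-identityʳ _ ⟨
        ∑ (intRange A) (λ a → χ (steepest? (a , p) v)) * 1  ≤⟨ spaced-intRange (λ a → steepest? (a , p) v) {u = 1} {L = 0}
                                                                (λ {x} {y} (_ , _ , ex) (_ , _ , ey) x≢y → ⊥-elim (x≢y (unique x y ex ey))) A ⟩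
        1                                                   ≡⟨ χ-yes (nearSol? k A b (gap p) D (+ 0) v) (nears , D∣s) ⟨
        χ (nearSol? k A b (gap p) D (+ 0) v)                ∎
        where
        open ≤-Reasoning
        s = formSum k v
        instance
          D≢0 : ℤ.NonZero d
          D≢0 = ℕ.>-nonZero (≤-trans (m^n>0 (gap p) {{ℕ.>-nonZero 0<gap}} k) (gap^k≤∣powerDiff∣ k p))
        unique : ∀ x y → x ℤ.* d ℤ.+ s ≡ + 0 → y ℤ.* d ℤ.+ s ≡ + 0 → x ≡ y
        unique x y ex ey = ℤP.*-cancelʳ-≡ x y d (ℤGroup.∙-cancelʳ s (x ℤ.* d) (y ℤ.* d) (trans ex (sym ey)))
        D∣s : + D ∣ + 0 ℤ.+ s
        D∣s = subst (+ D ∣_) (sym (ℤP.+-identityˡ s)) (ℤD.∣m+n∣m⇒∣n (subst (+ D ∣_) (sym sum≡0) (divides (+ 0) refl))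
                (ℤD.∣n⇒∣m*n a (ℤD.∣m∣∣m {d})))

      steepest-count : ∑ (intRange A) (λ a → ∑ (vecs T n) (λ v → χ (steepest? (a , p) v))) ≤ K
      steepest-count = by-gap (0 <? gap p)
        where
        open ≤-Reasoning
        by-gap : Dec (0 < gap p) → ∑ (intRange A) (λ a → ∑ (vecs T n) (λ v → χ (steepest? (a , p) v))) ≤ K
        by-gap (no ¬0<gap) = begin
          ∑ (intRange A) (λ a → ∑ (vecs T n) (λ v → χ (steepest? (a , p) v)))
            ≡⟨ ∑-cong (intRange A) (λ a → trans
                 (∑-cong (vecs T n) (λ v → χ-no (steepest? (a , p) v) (λ (0<gap , _) → ¬0<gap 0<gap)))
                 (trans (∑-const (vecs T n) 0) (*-zeroʳ (length (vecs T n))))) ⟩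
          ∑ (intRange A) (λ _ → 0)   ≡⟨ trans (∑-const (intRange A) 0) (*-zeroʳ (length (intRange A))) ⟩
          0                          ≤⟨ z≤n ⟩
          K                          ∎
        by-gap (yes 0<gap) = begin
          ∑ (intRange A) (λ a → ∑ (vecs T n) (λ v → χ (steepest? (a , p) v)))
            ≡⟨ ∑-swap (intRange A) (vecs T n) _ ⟩
          ∑ (vecs T n) (λ v → ∑ (intRange A) (λ a → χ (steepest? (a , p) v)))
            ≤⟨ ∑-mono (vecs T n) (coefficient-count 0<gap) ⟩
          #nearSol k A b (gap p) n D (+ 0)
            ≤⟨ nearSol≤K p p∈ 0<gap ⟩
          K ∎

  -- The first summand counts vectors all of whose gaps vanish: a and x are free, and y is x or -x.
  -- The second is made of the position of the steepest triple, its pair, and K choices for the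
  -- others. K stays abstract because the two ranges of t bound it differently.
  #zeros-bound : #zeros k (suc n) A b ≤ (suc (2 * A) * (suc (2 * b) * 2)) ^ suc n + suc n * (suc (2 * b) * suc (2 * b) * K)
  #zeros-bound = begin
    #zeros k (suc n) A b
      ≤⟨ ∑-mono (vecs T (suc n)) (λ v → χ-elim (formSum k v ℤP.≟ + 0) (cover v)) ⟩
    ∑ (vecs T (suc n)) (λ v → χ (All.all? Flat? v) + ∑ (allFin (suc n)) (λ i → χ (steepest? (lookup v i) (removeAt v i))))
      ≡⟨ ∑-distrib-+ (vecs T (suc n)) _ _ ⟩
    ∑ (vecs T (suc n)) (λ v → χ (All.all? Flat? v))
      + ∑ (vecs T (suc n)) (λ v → ∑ (allFin (suc n)) (λ i → χ (steepest? (lookup v i) (removeAt v i))))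
      ≤⟨ +-mono-≤ (≤-trans (∑-vecs-All Flat? T (suc n)) (^-monoˡ-≤ (suc n) flat-count)) position-sum ⟩
    (suc (2 * A) * (suc (2 * b) * 2)) ^ suc n + suc n * (suc (2 * b) * suc (2 * b) * K) ∎
    where
    open ≤-Reasoning
    position : ∀ i → ∑ (vecs T (suc n)) (λ v → χ (steepest? (lookup v i) (removeAt v i))) ≤ suc (2 * b) * suc (2 * b) * K
    position i = begin
      ∑ (vecs T (suc n)) (λ v → χ (steepest? (lookup v i) (removeAt v i)))
        ≡⟨ ∑-vecs-removeAt T i (λ t v → χ (steepest? t v)) ⟩
      ∑ T (λ t → ∑ (vecs T n) (λ v → χ (steepest? t v)))
        ≡⟨ ∑-cartesianProduct (intRange A) (pairs b) _ ⟩
      ∑ (intRange A) (λ a → ∑ (pairs b) (λ p → ∑ (vecs T n) (λ v → χ (steepest? (a , p) v))))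
        ≡⟨ ∑-swap (intRange A) (pairs b) _ ⟩
      ∑ (pairs b) (λ p → ∑ (intRange A) (λ a → ∑ (vecs T n) (λ v → χ (steepest? (a , p) v))))
        ≤⟨ ∑-bound-∈ (pairs b) steepest-count ⟩
      length (pairs b) * K
        ≡⟨ cong (_* K) (length-pairs b) ⟩
      suc (2 * b) * suc (2 * b) * K ∎
    position-sum : ∑ (vecs T (suc n)) (λ v → ∑ (allFin (suc n)) (λ i → χ (steepest? (lookup v i) (removeAt v i))))
                   ≤ suc n * (suc (2 * b) * suc (2 * b) * K)
    position-sum = begin
      ∑ (vecs T (suc n)) (λ v → ∑ (allFin (suc n)) (λ i → χ (steepest? (lookup v i) (removeAt v i))))
        ≡⟨ ∑-swap (vecs T (suc n)) (allFin (suc n)) _ ⟩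
      ∑ (allFin (suc n)) (λ i → ∑ (vecs T (suc n)) (λ v → χ (steepest? (lookup v i) (removeAt v i))))
        ≤⟨ ∑-bound-∈ (allFin (suc n)) (λ i _ → position i) ⟩
      length (allFin (suc n)) * (suc (2 * b) * suc (2 * b) * K)
        ≡⟨ cong (_* (suc (2 * b) * suc (2 * b) * K)) (length-tabulate {n = suc n} (λ i → i)) ⟩
      suc n * (suc (2 * b) * suc (2 * b) * K) ∎

-- Numerical estimates

1+2*m≤3*m : ∀ m .{{_ : NonZero m}} → suc (2 * m) ≤ 3 * m
1+2*m≤3*m m = +-monoˡ-≤ (2 * m) (ℕ.>-nonZero⁻¹ m)

length-triples : ∀ A b → length (triples A b) ≡ suc (2 * A) * (suc (2 * b) * suc (2 * b))
length-triples A b = begin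
  length (triples A b)                             ≡⟨ length≡∑1 (triples A b) ⟩
  ∑ (triples A b) (λ _ → 1)                        ≡⟨ ∑-cartesianProduct (intRange A) (pairs b) _ ⟩
  ∑ (intRange A) (λ _ → ∑ (pairs b) (λ _ → 1))     ≡⟨ ∑-const (intRange A) _ ⟩
  length (intRange A) * ∑ (pairs b) (λ _ → 1)      ≡⟨ cong (length (intRange A) *_) (length≡∑1 (pairs b)) ⟨
  length (intRange A) * length (pairs b)           ≡⟨ cong₂ _*_ (length-intRange A) (length-pairs b) ⟩
  suc (2 * A) * (suc (2 * b) * suc (2 * b))        ∎
  where open ≡-Reasoning

module _ (k : ℕ) (A b n : ℕ) {N Z : ℕ}
         (τ≤Z : ∀ m .{{_ : NonZero m}} → m ≤ N → τ m ≤ Z) (1≤Z : 1 ≤ Z) (N≤A : N ≤ A)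
         (k<n : suc k ≤ n) where

  private
    G : ℕ
    G = suc (2 * b) * (2 * Z ^ k)

  -- For w close to the root of g of order `suc k`, each count is at most G (2 E / w + 1). If w ≤ 2
  -- E, then g ≪ w ^ suc k ≤ w ^ n cancels the denominators, while E ^ n ≤ D b ^ (n ∸ suc k) because
  -- E ^ suc k ≤ D and E ≤ b. If w > 2 E, the count is O(G), and g ≤ D is enough. The factor 2 ^ suc
  -- k comes from suc w ≤ 2 w.
  #near-energy : ∀ E D → E ≤ b → D ≤ N → E ^ suc k ≤ D →
                 ∀ g .{{_ : NonZero g}} .{{_ : NonZero b}} → g ≤ D →
                 g * #near (suc k) b g E ^ n ≤ 2 ^ suc k * (4 * G) ^ n * (D * b ^ (n ∸ suc k))
  #near-energy E D E≤b D≤N E^k≤D g g≤D with ∃-floor-root (suc k) g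
  ... | zero , _ , g<1 = ⊥-elim (≤⇒≯ (ℕ.>-nonZero⁻¹ g) (subst (g <_) (^-zeroˡ (suc k)) g<1))
  ... | w@(suc _) , w^k≤g , g<[1+w]^k = by-size (w ≤? 2 * E)
    where
    open ≤-Reasoning
    P = #near (suc k) b g E
    P*w≤ : P * w ≤ G * (2 * E + w)
    P*w≤ = ≤-trans (#near-bound τ≤Z 1≤Z k b g E (≤-trans g≤D D≤N) w w^k≤g)
                   (≤-reflexive (regroup (suc (2 * b)) (Z ^ k) (2 * E + w)))
      where
      regroup : ∀ b z e → b * (2 * (z * e)) ≡ b * (2 * z) * e
      regroup = solve-∀
    g≤ : g ≤ 2 ^ suc k * w ^ n
    g≤ = begin
      g                        ≤⟨ <⇒≤ g<[1+w]^k ⟩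
      suc w ^ suc k            ≤⟨ ^-monoˡ-≤ (suc k) (+-mono-≤ {1} {w} (s≤s z≤n) (≤-reflexive (sym (+-identityʳ w)))) ⟩
      (2 * w) ^ suc k          ≡⟨ ^-distribʳ-* 2 w (suc k) ⟩
      2 ^ suc k * w ^ suc k    ≤⟨ *-monoʳ-≤ (2 ^ suc k) (^-monoʳ-≤ w k<n) ⟩
      2 ^ suc k * w ^ n        ∎
    E^n≤ : E ^ n ≤ D * b ^ (n ∸ suc k)
    E^n≤ = begin
      E ^ n                           ≡⟨ cong (E ^_) (m+[n∸m]≡n k<n) ⟨
      E ^ (suc k + (n ∸ suc k))       ≡⟨ ^-distribˡ-+-* E (suc k) (n ∸ suc k) ⟩
      E ^ suc k * E ^ (n ∸ suc k)     ≤⟨ *-mono-≤ E^k≤D (^-monoˡ-≤ (n ∸ suc k) E≤b) ⟩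
      D * b ^ (n ∸ suc k)             ∎
    by-size : Dec (w ≤ 2 * E) → g * P ^ n ≤ 2 ^ suc k * (4 * G) ^ n * (D * b ^ (n ∸ suc k))
    by-size (yes w≤2E) = *-cancelʳ-≤ _ _ (w ^ n) {{m^n≢0 w n}} (begin
      g * P ^ n * w ^ n                       ≡⟨ trans (*-assoc g (P ^ n) (w ^ n)) (cong (g *_) (sym (^-distribʳ-* P w n))) ⟩
      g * (P * w) ^ n                         ≤⟨ *-mono-≤ g≤ (^-monoˡ-≤ n (≤-trans P*w≤ (≤-trans
                                                   (*-monoʳ-≤ G (+-monoʳ-≤ (2 * E) w≤2E)) (≤-reflexive (four G E))))) ⟩
      2 ^ suc k * w ^ n * (4 * G * E) ^ n     ≡⟨ cong (2 ^ suc k * w ^ n *_) (^-distribʳ-* (4 * G) E n) ⟩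
      2 ^ suc k * w ^ n * ((4 * G) ^ n * E ^ n) ≤⟨ *-monoʳ-≤ (2 ^ suc k * w ^ n) (*-monoʳ-≤ ((4 * G) ^ n) E^n≤) ⟩
      2 ^ suc k * w ^ n * ((4 * G) ^ n * (D * b ^ (n ∸ suc k)))
                                              ≡⟨ regroup (2 ^ suc k) (w ^ n) ((4 * G) ^ n) (D * b ^ (n ∸ suc k)) ⟩
      2 ^ suc k * (4 * G) ^ n * (D * b ^ (n ∸ suc k)) * w ^ n ∎)
      where
      four : ∀ G E → G * (2 * E + 2 * E) ≡ 4 * G * E
      four = solve-∀
      regroup : ∀ a w g e → a * w * (g * e) ≡ a * g * e * w
      regroup = solve-∀
    by-size (no w≰2E) = begin
      g * P ^ n                                      ≤⟨ *-mono-≤ g≤D (^-monoˡ-≤ n P≤4G) ⟩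
      D * (4 * G) ^ n                                ≤⟨ *-monoˡ-≤ ((4 * G) ^ n) (m≤m*n D (b ^ (n ∸ suc k)) {{m^n≢0 b (n ∸ suc k)}}) ⟩
      D * b ^ (n ∸ suc k) * (4 * G) ^ n              ≡⟨ *-comm (D * b ^ (n ∸ suc k)) ((4 * G) ^ n) ⟩
      (4 * G) ^ n * (D * b ^ (n ∸ suc k))            ≤⟨ *-monoˡ-≤ _ (m≤n*m ((4 * G) ^ n) (2 ^ suc k) {{m^n≢0 2 (suc k)}}) ⟩
      2 ^ suc k * (4 * G) ^ n * (D * b ^ (n ∸ suc k)) ∎
      where
      P≤4G : P ≤ 4 * G
      P≤4G = *-cancelʳ-≤ P (4 * G) w (begin
        P * w              ≤⟨ P*w≤ ⟩
        G * (2 * E + w)    ≤⟨ *-monoʳ-≤ G (+-monoˡ-≤ w (<⇒≤ (≰⇒> w≰2E))) ⟩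
        -- Here 2 G would do; doubling it gives the constant of the other case.
        G * (w + w)        ≤⟨ *-monoʳ-≤ G (m≤m+n (w + w) (w + w)) ⟩
        G * (w + w + (w + w)) ≡⟨ four G w ⟩
        4 * G * w          ∎)
        where
        four : ∀ G w → G * (w + w + (w + w)) ≡ 4 * G * w
        four = solve-∀

  -- The factor D in `#near-energy` cancels against the modulus D. What remains depends neither on D
  -- nor on E, so it can serve as the common K for all steepest pairs.
  #nearSol-large : .{{_ : NonZero b}} → ∀ E D .{{_ : NonZero D}} → E ≤ b → D ≤ N → E ^ suc k ≤ D → ∀ c →
                   #nearSol (suc k) A b E n D c ≤ (3 * A * Z) ^ n * (2 ^ suc k * (4 * G) ^ n * b ^ (n ∸ suc k))
  #nearSol-large E D E≤b D≤N E^k≤D c = *-cancelʳ-≤ _ _ D (begin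
    #nearSol (suc k) A b E n D c * D                  ≡⟨ *-identityˡ _ ⟨
    1 * (#nearSol (suc k) A b E n D c * D)            ≤⟨ #nearSol-bound (suc k) A b E τ≤Z N≤A n D D≤N c 1 _ energy ⟩
    (3 * A * Z) ^ n * (2 ^ suc k * (4 * G) ^ n * (D * b ^ (n ∸ suc k)))
      ≡⟨ regroup ((3 * A * Z) ^ n) (2 ^ suc k * (4 * G) ^ n) D (b ^ (n ∸ suc k)) ⟩
    (3 * A * Z) ^ n * (2 ^ suc k * (4 * G) ^ n * b ^ (n ∸ suc k)) * D ∎)
    where
    open ≤-Reasoning
    regroup : ∀ x y D z → x * (y * (D * z)) ≡ x * (y * z) * D
    regroup = solve-∀
    energy : ∀ g → g ℕD.∣ D → 1 * (g * #near (suc k) b g E ^ n) ≤ 2 ^ suc k * (4 * G) ^ n * (D * b ^ (n ∸ suc k))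
    energy g g∣D@(ℕD.divides m D≡mg) = ≤-trans (≤-reflexive (*-identityˡ _))
      (#near-energy E D E≤b D≤N E^k≤D g (∣⇒≤ g∣D))
      where
      instance
        g≢0 : NonZero g
        g≢0 = ℕ.≢-nonZero (λ e → ℕ.≢-nonZero⁻¹ D (trans D≡mg (trans (cong (λ x → m * x) e) (*-zeroʳ m))))

-- Few and many variables

module _ (k : ℕ) (A b n : ℕ) .{{_ : NonZero b}} where

  private
    t = suc n
    C₁ = 18 ^ t

  flat-bound : .{{_ : NonZero A}} → (suc (2 * A) * (suc (2 * b) * 2)) ^ t ≤ C₁ * (A * b) ^ t
  flat-bound = begin
    (suc (2 * A) * (suc (2 * b) * 2)) ^ t ≤⟨ ^-monoˡ-≤ t (*-mono-≤ (1+2*m≤3*m A) (*-monoˡ-≤ 2 (1+2*m≤3*m b))) ⟩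
    (3 * A * (3 * b * 2)) ^ t             ≡⟨ cong (_^ t) (eighteen A b) ⟩
    (18 * (A * b)) ^ t                    ≡⟨ ^-distribʳ-* 18 (A * b) t ⟩
    C₁ * (A * b) ^ t                      ∎
    where
    open ≤-Reasoning
    eighteen : ∀ A b → 3 * A * (3 * b * 2) ≡ 18 * (A * b)
    eighteen = solve-∀

  #zeros-few-variables : t ≤ suc k → 2 * b ^ suc k ≤ A →
    #zeros (suc k) t A b ≤ (C₁ + t * 9 * 27 ^ n) * (A * b) ^ t
  #zeros-few-variables t≤k 2b^k≤A = begin
    #zeros (suc k) t A b
      ≤⟨ #zeros-bound (suc k) A b n (length (triples A b) ^ n)
           (λ p _ _ → ∑-vecs-≤1 (triples A b) n (λ v → χ≤1 (nearSol? (suc k) A b (gap p) (abs (powerDiff (suc k) p)) (+ 0) v))) ⟩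
    (suc (2 * A) * (suc (2 * b) * 2)) ^ t + t * (suc (2 * b) * suc (2 * b) * length (triples A b) ^ n)
      ≤⟨ +-mono-≤ flat-bound (*-monoʳ-≤ t (*-mono-≤ (*-mono-≤ (1+2*m≤3*m b) (1+2*m≤3*m b)) (^-monoˡ-≤ n triples≤))) ⟩
    C₁ * (A * b) ^ t + t * (3 * b * (3 * b) * (27 * (A * b * b)) ^ n)
      ≡⟨ cong (λ x → C₁ * (A * b) ^ t + t * (3 * b * (3 * b) * x)) (trans (^-distribʳ-* 27 (A * b * b) n) (cong (27 ^ n *_) (^-distribʳ-* (A * b) b n))) ⟩
    C₁ * (A * b) ^ t + t * (3 * b * (3 * b) * (27 ^ n * ((A * b) ^ n * b ^ n)))
      ≡⟨ cong (λ x → C₁ * (A * b) ^ t + x) (regroup t b (27 ^ n) ((A * b) ^ n) (b ^ n)) ⟩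
    C₁ * (A * b) ^ t + t * 9 * 27 ^ n * (b ^ t * b * (A * b) ^ n)
      ≤⟨ +-monoʳ-≤ (C₁ * (A * b) ^ t) (*-monoʳ-≤ (t * 9 * 27 ^ n) (*-monoˡ-≤ ((A * b) ^ n) (*-monoˡ-≤ b b^t≤A))) ⟩
    C₁ * (A * b) ^ t + t * 9 * 27 ^ n * (A * b) ^ t
      ≡⟨ *-distribʳ-+ ((A * b) ^ t) C₁ (t * 9 * 27 ^ n) ⟨
    (C₁ + t * 9 * 27 ^ n) * (A * b) ^ t ∎
    where
    open ≤-Reasoning
    b^k≤A : b ^ suc k ≤ A
    b^k≤A = ≤-trans (m≤n*m (b ^ suc k) 2) 2b^k≤A
    instance
      A≢0 : NonZero A
      A≢0 = ℕ.>-nonZero (≤-trans (m^n>0 b (suc k)) b^k≤A)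
    -- The trivial count has one factor A less than (A b) ^ t and the surplus b ^ t in its place; t
    -- ≤ `suc k` lets A pay for that surplus.
    b^t≤A : b ^ t ≤ A
    b^t≤A = ≤-trans (^-monoʳ-≤ b t≤k) b^k≤A
    triples≤ : length (triples A b) ≤ 27 * (A * b * b)
    triples≤ = begin
      length (triples A b)                       ≡⟨ length-triples A b ⟩
      suc (2 * A) * (suc (2 * b) * suc (2 * b))  ≤⟨ *-mono-≤ (1+2*m≤3*m A) (*-mono-≤ (1+2*m≤3*m b) (1+2*m≤3*m b)) ⟩
      3 * A * (3 * b * (3 * b))                  ≡⟨ twentySeven A b ⟩
      27 * (A * b * b)                           ∎
      where
      twentySeven : ∀ A b → 3 * A * (3 * b * (3 * b)) ≡ 27 * (A * b * b)
      twentySeven = solve-∀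
    regroup : ∀ t b c x y → t * (3 * b * (3 * b) * (c * (x * y))) ≡ t * 9 * c * (b * y * b * x)
    regroup = solve-∀

  #zeros-many-variables : ∀ {Z} → suc k ≤ n → 2 * b ^ suc k ≤ A →
    (∀ m .{{_ : NonZero m}} → m ≤ 2 * b ^ suc k → τ m ≤ Z) → 1 ≤ Z →
    #zeros (suc k) t A b ≤ C₁ * (A * b) ^ t + t * 9 * 2 ^ suc k * 72 ^ n * (A ^ n * b ^ (2 * t ∸ suc k) * (Z ^ suc k) ^ n)
  #zeros-many-variables {Z} k<n 2b^k≤A τ≤Z 1≤Z = begin
    #zeros (suc k) t A b
      ≤⟨ #zeros-bound (suc k) A b n K nearSol≤K ⟩
    (suc (2 * A) * (suc (2 * b) * 2)) ^ t + t * (suc (2 * b) * suc (2 * b) * K)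
      ≤⟨ +-mono-≤ flat-bound (*-monoʳ-≤ t (*-mono-≤ (*-mono-≤ (1+2*m≤3*m b) (1+2*m≤3*m b)) K≤)) ⟩
    C₁ * (A * b) ^ t + t * (3 * b * (3 * b) * (72 ^ n * (A ^ n * b ^ n * (Z ^ suc k) ^ n) * (2 ^ suc k * b ^ (n ∸ suc k))))
      ≡⟨ cong (λ x → C₁ * (A * b) ^ t + x) (regroup t b (72 ^ n) (A ^ n) (b ^ n) ((Z ^ suc k) ^ n) (2 ^ suc k) (b ^ (n ∸ suc k))) ⟩
    C₁ * (A * b) ^ t + t * 9 * 2 ^ suc k * 72 ^ n * (A ^ n * (b ^ t * (b * b ^ (n ∸ suc k))) * (Z ^ suc k) ^ n)
      ≡⟨ cong (λ x → C₁ * (A * b) ^ t + t * 9 * 2 ^ suc k * 72 ^ n * (A ^ n * x * (Z ^ suc k) ^ n)) exponents ⟩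
    C₁ * (A * b) ^ t + t * 9 * 2 ^ suc k * 72 ^ n * (A ^ n * b ^ (2 * t ∸ suc k) * (Z ^ suc k) ^ n) ∎
    where
    open ≤-Reasoning
    K = (3 * A * Z) ^ n * (2 ^ suc k * (4 * (suc (2 * b) * (2 * Z ^ k))) ^ n * b ^ (n ∸ suc k))
    instance
      A≢0 : NonZero A
      A≢0 = ℕ.>-nonZero (≤-trans (m^n>0 b (suc k)) (≤-trans (m≤n*m (b ^ suc k) 2) 2b^k≤A))
    nearSol≤K : ∀ p → p ∈ pairs b → 0 < gap p →
                #nearSol (suc k) A b (gap p) n (abs (powerDiff (suc k) p)) (+ 0) ≤ K
    nearSol≤K p p∈ 0<gap = #nearSol-large k A b n τ≤Z 1≤Z 2b^k≤A k<n (gap p) (abs (powerDiff (suc k) p))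
      {{ℕ.>-nonZero (≤-trans (m^n>0 (gap p) {{ℕ.>-nonZero 0<gap}} (suc k)) (gap^k≤∣powerDiff∣ (suc k) p))}}
      (∈-pairs⇒gap≤ {b} p∈) (∈-pairs⇒∣powerDiff∣≤ {b} p∈ (suc k)) (gap^k≤∣powerDiff∣ (suc k) p) (+ 0)
    K≤ : K ≤ 72 ^ n * (A ^ n * b ^ n * (Z ^ suc k) ^ n) * (2 ^ suc k * b ^ (n ∸ suc k))
    K≤ = begin
      K ≤⟨ *-monoʳ-≤ ((3 * A * Z) ^ n) (*-monoˡ-≤ (b ^ (n ∸ suc k)) (*-monoʳ-≤ (2 ^ suc k)
             (^-monoˡ-≤ n (*-monoʳ-≤ 4 (*-monoˡ-≤ (2 * Z ^ k) (1+2*m≤3*m b)))))) ⟩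
      (3 * A * Z) ^ n * (2 ^ suc k * (4 * (3 * b * (2 * Z ^ k))) ^ n * b ^ (n ∸ suc k))
        ≡⟨ pull ((3 * A * Z) ^ n) (2 ^ suc k) ((4 * (3 * b * (2 * Z ^ k))) ^ n) (b ^ (n ∸ suc k)) ⟩
      (3 * A * Z) ^ n * (4 * (3 * b * (2 * Z ^ k))) ^ n * (2 ^ suc k * b ^ (n ∸ suc k))
        ≡⟨ cong (_* (2 ^ suc k * b ^ (n ∸ suc k))) (trans (sym (^-distribʳ-* (3 * A * Z) (4 * (3 * b * (2 * Z ^ k))) n)) power) ⟩
      72 ^ n * (A ^ n * b ^ n * (Z ^ suc k) ^ n) * (2 ^ suc k * b ^ (n ∸ suc k)) ∎
      where
      pull : ∀ x c y z → x * (c * y * z) ≡ x * y * (c * z)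
      pull = solve-∀
      -- Per remaining triple: 3 from the coefficients, 4 from `#near-energy`, 3 from 2 b + 1 ≤ 3 b,
      -- and 2 from the two windows.
      seventyTwo : ∀ A Z b z → 3 * A * Z * (4 * (3 * b * (2 * z))) ≡ 72 * (A * b * (Z * z))
      seventyTwo = solve-∀
      power : (3 * A * Z * (4 * (3 * b * (2 * Z ^ k)))) ^ n ≡ 72 ^ n * (A ^ n * b ^ n * (Z ^ suc k) ^ n)
      power = trans (cong (_^ n) (seventyTwo A Z b (Z ^ k)))
             (trans (^-distribʳ-* 72 (A * b * Z ^ suc k) n)
             (cong (72 ^ n *_) (trans (^-distribʳ-* (A * b) (Z ^ suc k) n) (cong (_* (Z ^ suc k) ^ n) (^-distribʳ-* A b n)))))
    regroup : ∀ t b s x y z c d → t * (3 * b * (3 * b) * (s * (x * y * z) * (c * d)))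
                                ≡ t * 9 * c * s * (x * (b * y * (b * d)) * z)
    regroup = solve-∀
    -- The powers of b come from the factor G ^ n (n of them), the steepest pair (2) and
    -- `#near-energy` (n ∸ suc k).
    exponents : b ^ t * (b * b ^ (n ∸ suc k)) ≡ b ^ (2 * t ∸ suc k)
    exponents = trans (sym (^-distribˡ-+-* b t (suc (n ∸ suc k)))) (cong (b ^_) (begin-equality
      t + suc (n ∸ suc k)     ≡⟨ cong (λ x → t + x) (+-∸-assoc 1 k<n) ⟨
      t + (t ∸ suc k)         ≡⟨ +-∸-assoc t (m≤n⇒m≤1+n k<n) ⟨
      t + t ∸ suc k           ≡⟨ cong (λ x → t + x ∸ suc k) (+-identityʳ t) ⟨
      2 * t ∸ suc k           ∎))

-- J is the number of factors Z that accumulate. With Q = J q k, take Z to be the integer part of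
-- the Q-th root of 2 C b ^ k: it bounds τ because τ(m) ^ Q ≤ C m, and Z ^ Q ≤ (2 C b) ^ k yields
-- the last claim after a k-th root.
∃-divisor-scale : ∀ J q k .{{_ : NonZero J}} .{{_ : NonZero q}} .{{_ : NonZero k}} →
  ∃ λ C → ∀ b .{{_ : NonZero b}} → ∃ λ Z →
    1 ≤ Z × (∀ m .{{_ : NonZero m}} → m ≤ 2 * b ^ k → τ m ≤ Z) × (Z ^ J) ^ q ≤ C * b
∃-divisor-scale J q k = 2 * C , λ b →
    let M = C * (2 * b ^ k)
        Z , Z^Q≤M , M<[1+Z]^Q = ∃-floor-root Q M
        τ≤Z : ∀ m .{{_ : NonZero m}} → m ≤ 2 * b ^ k → τ m ≤ Z
        τ≤Z m m≤ = ≮⇒≥ (λ Z<τ → <⇒≱ M<[1+Z]^Q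
          (≤-trans (^-monoˡ-≤ Q Z<τ) (≤-trans (τ^Q≤ m) (*-monoʳ-≤ C m≤))))
        open ≤-Reasoning
    -- `τ 1` computes to 1, so the lower bound for Z is the instance m = 1 of the upper bound for τ.
    in Z , τ≤Z 1 (≤-trans (m^n>0 b k) (m≤n*m (b ^ k) 2)) , τ≤Z , ^-cancelˡ-≤ k (begin
      ((Z ^ J) ^ q) ^ k     ≡⟨ cong (_^ k) (^-*-assoc Z J q) ⟩
      (Z ^ (J * q)) ^ k     ≡⟨ ^-*-assoc Z (J * q) k ⟩
      Z ^ Q                 ≤⟨ Z^Q≤M ⟩
      C * (2 * b ^ k)       ≡⟨ trans (sym (*-assoc C 2 (b ^ k))) (cong (_* b ^ k) (*-comm C 2)) ⟩
      2 * C * b ^ k         ≤⟨ *-monoˡ-≤ (b ^ k) (m≤m^n (2 * C) k) ⟩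
      (2 * C) ^ k * b ^ k   ≡⟨ ^-distribʳ-* (2 * C) b k ⟨
      (2 * C * b) ^ k       ∎)
  where
  Q = J * q * k
  instance
    Q≢0 : NonZero Q
    Q≢0 = m*n≢0 (J * q) k {{m*n≢0 J q}}
  C = proj₁ (τ-bound Q)
  τ^Q≤ = proj₂ (τ-bound Q)

-- Z plays the role of b ^ ε.
ZerosBound : (k n q C : ℕ) → Set
ZerosBound k n q C = ∀ a b .{{_ : NonZero b}} → 2 * b ^ suc k ≤ a →
  #zeros (suc k) (suc n) a b ≤ C * (a * b) ^ suc n
  ⊎ (suc k ≤ 2 * suc n × ∃ λ Z → Z ^ q ≤ C * b ×
      #zeros (suc k) (suc n) a b ≤ C * ((a * b) ^ suc n + a ^ n * b ^ (2 * suc n ∸ suc k) * Z))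

zerosBound : ∀ k n q .{{_ : NonZero q}} → ∃ (ZerosBound k n q)
zerosBound k n q = by-size (suc k ≤? n)
  where
  by-size : Dec (suc k ≤ n) → ∃ (ZerosBound k n q)
  by-size (no k≮n) = 18 ^ suc n + suc n * 9 * 27 ^ n , few
    where
    few : ZerosBound k n q (18 ^ suc n + suc n * 9 * 27 ^ n)
    few a b 2b^k≤a = inj₁ (#zeros-few-variables k a b n (≰⇒> k≮n) 2b^k≤a)
  by-size (yes k<n) = C , many
    where
    instance
      n≢0 : NonZero n
      n≢0 = ℕ.>-nonZero (≤-trans (s≤s z≤n) k<n)
      J≢0 : NonZero (suc k * n)
      J≢0 = m*n≢0 (suc k) n
    C₁ = 18 ^ suc n
    C₂ = suc n * 9 * 2 ^ suc k * 72 ^ n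
    scale = ∃-divisor-scale (suc k * n) q (suc k)
    C₃ = proj₁ scale
    C  = C₁ + C₂ + C₃
    many : ZerosBound k n q C
    many a b 2b^k≤a with proj₂ scale b
    ... | Z , 1≤Z , τ≤Z , Z^≤ = inj₂ (≤-trans k<n (≤-trans (n≤1+n n) (m≤m+n (suc n) _)) , (Z ^ suc k) ^ n
      , (begin
        ((Z ^ suc k) ^ n) ^ q      ≡⟨ cong (_^ q) (^-*-assoc Z (suc k) n) ⟩
        (Z ^ (suc k * n)) ^ q      ≤⟨ Z^≤ ⟩
        C₃ * b                     ≤⟨ *-monoˡ-≤ b (m≤n+m C₃ (C₁ + C₂)) ⟩
        C * b                      ∎)
      , (begin
        #zeros (suc k) (suc n) a b ≤⟨ #zeros-many-variables k a b n k<n 2b^k≤a τ≤Z 1≤Z ⟩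
        C₁ * X + C₂ * Y            ≤⟨ +-mono-≤ (*-monoˡ-≤ X (≤-trans (m≤m+n C₁ C₂) (m≤m+n (C₁ + C₂) C₃)))
                                               (*-monoˡ-≤ Y (≤-trans (m≤n+m C₂ C₁) (m≤m+n (C₁ + C₂) C₃))) ⟩
        C * X + C * Y              ≡⟨ *-distribˡ-+ C X Y ⟨
        C * (X + Y)                ∎))
      where
      open ≤-Reasoning
      X = (a * b) ^ suc n
      Y = a ^ n * b ^ (2 * suc n ∸ suc k) * (Z ^ suc k) ^ n

U≤#zeros : ∀ k t A B → U k t A B ≤ #zeros k t (abs (ℚ.floor A)) (abs (ℚ.floor B))
U≤#zeros k t A B = ≤-trans (≤-reflexive (length-filter≡∑ (isSol? k A B) vs))
  (∑-mono vs (λ v → χ-mono (isSol? k A B v) (formSum k v ℤP.≟ + 0) proj₂))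
  where vs = vecs (candidates A B) t

-- Passage to rational parameters

ι : ℕ → ℚ
ι n = toℚ (+ n)

toℚᵘ-ι : ∀ n → ℚ.toℚᵘ (ι n) ℚᵘ.≃ mkℚᵘ (+ n) 0
toℚᵘ-ι n = ℚP.toℚᵘ-fromℚᵘ (mkℚᵘ (+ n) 0)

ι-+ : ∀ m n → ι (m + n) ≡ ι m ℚ.+ ι n
ι-+ m n = ℚP.toℚᵘ-injective (begin
  ℚ.toℚᵘ (ι (m + n))                  ≈⟨ toℚᵘ-ι (m + n) ⟩
  mkℚᵘ (+ (m + n)) 0                  ≈⟨ ℚᵘ.*≡* (cong (ℤ._* + 1) (sym (cong₂ ℤ._+_ (ℤP.*-identityʳ (+ m)) (ℤP.*-identityʳ (+ n))))) ⟩
  mkℚᵘ (+ m) 0 ℚᵘ.+ mkℚᵘ (+ n) 0      ≈⟨ ℚᵘP.+-cong (toℚᵘ-ι m) (toℚᵘ-ι n) ⟨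
  ℚ.toℚᵘ (ι m) ℚᵘ.+ ℚ.toℚᵘ (ι n)      ≈⟨ ℚP.toℚᵘ-homo-+ (ι m) (ι n) ⟨
  ℚ.toℚᵘ (ι m ℚ.+ ι n)                ∎)
  where open ℚᵘP.≃-Reasoning

ι-* : ∀ m n → ι (m * n) ≡ ι m ℚ.* ι n
ι-* m n = ℚP.toℚᵘ-injective (begin
  ℚ.toℚᵘ (ι (m * n))                  ≈⟨ toℚᵘ-ι (m * n) ⟩
  mkℚᵘ (+ (m * n)) 0                  ≈⟨ ℚᵘ.*≡* (cong (ℤ._* + 1) (ℤP.pos-* m n)) ⟩
  mkℚᵘ (+ m) 0 ℚᵘ.* mkℚᵘ (+ n) 0      ≈⟨ ℚᵘP.*-cong (toℚᵘ-ι m) (toℚᵘ-ι n) ⟨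
  ℚ.toℚᵘ (ι m) ℚᵘ.* ℚ.toℚᵘ (ι n)      ≈⟨ ℚP.toℚᵘ-homo-* (ι m) (ι n) ⟨
  ℚ.toℚᵘ (ι m ℚ.* ι n)                ∎)
  where open ℚᵘP.≃-Reasoning

ι-^ : ∀ m n → ι (m ^ n) ≡ ι m ^ℚ n
ι-^ m zero    = refl
ι-^ m (suc n) = trans (ι-* m (m ^ n)) (cong (ι m ℚ.*_) (ι-^ m n))

ι-mono-≤ : ∀ {m n} → m ≤ n → ι m ℚ.≤ ι n
ι-mono-≤ {m} {n} m≤n = ℚP.toℚᵘ-cancel-≤ (begin
  ℚ.toℚᵘ (ι m)    ≃⟨ toℚᵘ-ι m ⟩
  mkℚᵘ (+ m) 0    ≤⟨ ℚᵘ.*≤* (ℤP.*-monoʳ-≤-nonNeg (+ 1) (ℤ.+≤+ m≤n)) ⟩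
  mkℚᵘ (+ n) 0    ≃⟨ toℚᵘ-ι n ⟨
  ℚ.toℚᵘ (ι n)    ∎)
  where open ℚᵘP.≤-Reasoning

0≤ι : ∀ n → 0ℚ ℚ.≤ ι n
0≤ι n = ι-mono-≤ {0} {n} z≤n

0≤1 : 0ℚ ℚ.≤ 1ℚ
0≤1 = ℚP.nonNegative⁻¹ 1ℚ

∣floor∣≡ : ∀ n d → abs ((+ n) ℤ./ (+ suc d)) ≡ n ℕ./ suc d
∣floor∣≡ n d = cong abs (ℤP.*-identityˡ (+ (n ℕ./ suc d)))

ι∣floor∣≤ : ∀ {A} → 0ℚ ℚ.≤ A → ι (abs (ℚ.floor A)) ℚ.≤ A
ι∣floor∣≤ {mkℚ -[1+ _ ] _ _}    (ℚ.*≤* ())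
ι∣floor∣≤ {A@(mkℚ (+ n) d _)} _ = ℚP.toℚᵘ-cancel-≤ (begin
  ℚ.toℚᵘ (ι (abs (ℚ.floor A)))    ≃⟨ toℚᵘ-ι (abs (ℚ.floor A)) ⟩
  mkℚᵘ (+ abs (ℚ.floor A)) 0      ≤⟨ ℚᵘ.*≤* (subst₂ ℤ._≤_
                                       (trans (ℤP.pos-* (n ℕ./ suc d) (suc d)) (cong (λ m → + m ℤ.* + suc d) (sym (∣floor∣≡ n d))))
                                       (sym (ℤP.*-identityʳ (+ n)))
                                       (ℤ.+≤+ (m/n*n≤m n (suc d)))) ⟩
  mkℚᵘ (+ n) d                    ∎)
  where open ℚᵘP.≤-Reasoning

ι≤⇒≤∣floor∣ : ∀ {A} → 0ℚ ℚ.≤ A → ∀ {m} → ι m ℚ.≤ A → m ≤ abs (ℚ.floor A)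
ι≤⇒≤∣floor∣ {mkℚ -[1+ _ ] _ _}    (ℚ.*≤* ())
ι≤⇒≤∣floor∣ {A@(mkℚ (+ n) d _)} _ {m} ιm≤A = begin
  m                       ≡⟨ m*n/n≡m m (suc d) ⟨
  m * suc d ℕ./ suc d     ≤⟨ /-monoˡ-≤ (suc d) m*d≤n ⟩
  n ℕ./ suc d             ≡⟨ ∣floor∣≡ n d ⟨
  abs (ℚ.floor A)         ∎
  where
  open ≤-Reasoning
  m≤A : mkℚᵘ (+ m) 0 ℚᵘ.≤ mkℚᵘ (+ n) d
  m≤A = ℚᵘP.≤-respˡ-≃ (toℚᵘ-ι m) (ℚP.toℚᵘ-mono-≤ ιm≤A)
  m*d≤n : m * suc d ≤ n
  m*d≤n = ℤP.drop‿+≤+ (subst₂ ℤ._≤_ (sym (ℤP.pos-* m (suc d))) (ℤP.*-identityʳ (+ n)) (ℚᵘP.drop-*≤* m≤A))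

*ℚ-mono-≤ : ∀ {p q r s} → 0ℚ ℚ.≤ r → 0ℚ ℚ.≤ q → p ℚ.≤ q → r ℚ.≤ s → p ℚ.* r ℚ.≤ q ℚ.* s
*ℚ-mono-≤ {p} {q} {r} {s} 0≤r 0≤q p≤q r≤s = ℚP.≤-trans
  (ℚP.*-monoʳ-≤-nonNeg r {{ℚ.nonNegative 0≤r}} p≤q) (ℚP.*-monoˡ-≤-nonNeg q {{ℚ.nonNegative 0≤q}} r≤s)

0≤* : ∀ {p q} → 0ℚ ℚ.≤ p → 0ℚ ℚ.≤ q → 0ℚ ℚ.≤ p ℚ.* q
0≤* {p} {q} 0≤p 0≤q = ℚP.nonNegative⁻¹ (p ℚ.* q)
  {{ℚP.nonNeg*nonNeg⇒nonNeg p {{ℚ.nonNegative 0≤p}} q {{ℚ.nonNegative 0≤q}}}}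

0≤^ℚ : ∀ {p} n → 0ℚ ℚ.≤ p → 0ℚ ℚ.≤ p ^ℚ n
0≤^ℚ zero    0≤p = 0≤1
0≤^ℚ (suc n) 0≤p = 0≤* 0≤p (0≤^ℚ n 0≤p)

^ℚ-mono-≤ : ∀ {p q} n → 0ℚ ℚ.≤ p → p ℚ.≤ q → p ^ℚ n ℚ.≤ q ^ℚ n
^ℚ-mono-≤ zero    0≤p p≤q = ℚP.≤-refl
^ℚ-mono-≤ (suc n) 0≤p p≤q = *ℚ-mono-≤ (0≤^ℚ n 0≤p) (ℚP.≤-trans 0≤p p≤q) p≤q (^ℚ-mono-≤ n 0≤p p≤q)

0<^ℚ : ∀ {p} n → 0ℚ ℚ.< p → 0ℚ ℚ.< p ^ℚ n
0<^ℚ     zero    0<p = ℚP.positive⁻¹ 1ℚ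
0<^ℚ {p} (suc n) 0<p = ℚP.positive⁻¹ (p ^ℚ suc n)
  {{ℚP.pos*pos⇒pos p {{ℚ.positive 0<p}} (p ^ℚ n) {{ℚ.positive (0<^ℚ n 0<p)}}}}

^ℚ-mono-< : ∀ {p q} n .{{_ : NonZero n}} → 0ℚ ℚ.≤ p → p ℚ.< q → p ^ℚ n ℚ.< q ^ℚ n
^ℚ-mono-< {p} {q} (suc n) 0≤p p<q = ℚP.≤-<-trans
  (ℚP.*-monoˡ-≤-nonNeg p {{ℚ.nonNegative 0≤p}} (^ℚ-mono-≤ n 0≤p (ℚP.<⇒≤ p<q)))
  (ℚP.*-monoˡ-<-pos (q ^ℚ n) {{ℚ.positive (0<^ℚ n (ℚP.≤-<-trans 0≤p p<q))}} p<q)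

^ℚ-cancel-≤ : ∀ {p q} n .{{_ : NonZero n}} → 0ℚ ℚ.≤ q → p ^ℚ n ℚ.≤ q ^ℚ n → p ℚ.≤ q
^ℚ-cancel-≤ n 0≤q le = ℚP.≮⇒≥ (λ q<p → ℚP.<-irrefl refl (ℚP.<-≤-trans (^ℚ-mono-< n 0≤q q<p) le))

^ℚ-distrib-* : ∀ p q n → (p ℚ.* q) ^ℚ n ≡ p ^ℚ n ℚ.* q ^ℚ n
^ℚ-distrib-* p q zero    = refl
^ℚ-distrib-* p q (suc n) = trans (cong (p ℚ.* q ℚ.*_) (^ℚ-distrib-* p q n)) (ℚ*.interchange p q (p ^ℚ n) (q ^ℚ n))

0≤powℤ : ∀ {B} (0<B : 0ℚ ℚ.< B) z → 0ℚ ℚ.≤ powℤ B {{>-nonZero 0<B}} z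
0≤powℤ {B} 0<B (+ n)     = 0≤^ℚ n (ℚP.<⇒≤ 0<B)
0≤powℤ {B} 0<B -[1+ n ] = 0≤^ℚ (suc n) (ℚP.<⇒≤ (ℚP.positive⁻¹ ((ℚ.1/ B) {{>-nonZero 0<B}})
  {{ℚP.1/pos⇒pos B {{ℚ.positive 0<B}}}}))

ι-combine-≤ : ∀ {u X Y c d C} → 0ℚ ℚ.≤ X → 0ℚ ℚ.≤ Y → c ≤ C → d ≤ C →
              u ℚ.≤ ι c ℚ.* X ℚ.+ ι d ℚ.* Y → u ℚ.≤ ι C ℚ.* (X ℚ.+ Y)
ι-combine-≤ {u} {X} {Y} {c} {d} {C} 0≤X 0≤Y c≤C d≤C u≤ = ℚP.≤-trans u≤ (ℚP.≤-trans
  (ℚP.+-mono-≤ (ℚP.*-monoʳ-≤-nonNeg X {{ℚ.nonNegative 0≤X}} (ι-mono-≤ c≤C))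
               (ℚP.*-monoʳ-≤-nonNeg Y {{ℚ.nonNegative 0≤Y}} (ι-mono-≤ d≤C)))
  (ℚP.≤-reflexive (sym (ℚP.*-distribˡ-+ (ι C) X Y))))

≤-+ʳ : ∀ {u x y} → 0ℚ ℚ.≤ y → u ℚ.≤ x → u ℚ.≤ x ℚ.+ y
≤-+ʳ {u} 0≤y u≤x = ℚP.≤-trans (ℚP.≤-reflexive (sym (ℚP.+-identityʳ u))) (ℚP.+-mono-≤ u≤x 0≤y)

module _ (k n : ℕ) (A B : ℚ) (0<B : 0ℚ ℚ.< B)
         (2B^k≤A : ι 2 ℚ.* (B ^ℚ suc k) ℚ.≤ A) (1≤2B^k : 1ℚ ℚ.≤ ι 2 ℚ.* (B ^ℚ suc k)) where

  private
    t = suc n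
    0≤B = ℚP.<⇒≤ 0<B
    1≤A = ℚP.≤-trans 1≤2B^k 2B^k≤A
    0≤A = ℚP.≤-trans 0≤1 1≤A
    a = abs (ℚ.floor A)
    b = abs (ℚ.floor B)
    ιa≤A = ι∣floor∣≤ 0≤A
    ιb≤B = ι∣floor∣≤ 0≤B

  floor-ab-bound : ι ((a * b) ^ t) ℚ.≤ (A ℚ.* B) ^ℚ t
  floor-ab-bound = ℚP.≤-trans (ℚP.≤-reflexive (trans (ι-^ (a * b) t) (cong (_^ℚ t) (ι-* a b))))
    (^ℚ-mono-≤ t (0≤* (0≤ι a) (0≤ι b)) (*ℚ-mono-≤ (0≤ι b) 0≤A ιa≤A ιb≤B))

  2b^k≤a : 2 * b ^ suc k ≤ a
  2b^k≤a = ι≤⇒≤∣floor∣ 0≤A (ℚP.≤-trans (ℚP.≤-reflexive (trans (ι-* 2 (b ^ suc k)) (cong (ι 2 ℚ.*_) (ι-^ b (suc k)))))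
    (ℚP.≤-trans (ℚP.*-monoˡ-≤-nonNeg (ι 2) {{ℚ.nonNegative (0≤ι 2)}} (^ℚ-mono-≤ (suc k) (0≤ι b) ιb≤B)) 2B^k≤A))

  -- A bound by (a b) ^ t would be 0 here, although x = y = 0 leaves every choice of coefficients.
  -- Instead B ≤ 1 gives B ^ suc k ≤ B, so 1 ≤ 2 B ^ suc k yields 1 ≤ 2 B. Hence 3 a ≤ 6 A B for
  -- each triple.
  #zeros-b≡0 : b ≡ 0 → ι (#zeros (suc k) t a b) ℚ.≤ ι (6 ^ t) ℚ.* (A ℚ.* B) ^ℚ t
  #zeros-b≡0 b≡0 = begin
    ι (#zeros (suc k) t a b)        ≤⟨ ι-mono-≤ (≤-trans (∑-vecs-≤1 (triples a b) t (λ v → χ≤1 (formSum (suc k) v ℤP.≟ + 0)))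
                                         (^-monoˡ-≤ t triples≤)) ⟩
    ι ((3 * a) ^ t)                 ≡⟨ ι-^ (3 * a) t ⟩
    ι (3 * a) ^ℚ t                  ≤⟨ ^ℚ-mono-≤ t (0≤ι (3 * a)) 3a≤ ⟩
    (ι 6 ℚ.* (A ℚ.* B)) ^ℚ t        ≡⟨ ^ℚ-distrib-* (ι 6) (A ℚ.* B) t ⟩
    ι 6 ^ℚ t ℚ.* (A ℚ.* B) ^ℚ t     ≡⟨ cong (ℚ._* (A ℚ.* B) ^ℚ t) (ι-^ 6 t) ⟨
    ι (6 ^ t) ℚ.* (A ℚ.* B) ^ℚ t    ∎
    where
    open ℚP.≤-Reasoning
    instance
      a≢0 : NonZero a
      a≢0 = ℕ.>-nonZero (ι≤⇒≤∣floor∣ 0≤A {1} 1≤A)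
    triples≤ : length (triples a b) ≤ 3 * a
    triples≤ = ≤-trans (≤-reflexive (trans (length-triples a b)
      (trans (cong (λ c → suc (2 * a) * (suc (2 * c) * suc (2 * c))) b≡0) (*-identityʳ (suc (2 * a))))))
      (1+2*m≤3*m a)
    B≤1 : B ℚ.≤ 1ℚ
    B≤1 = ℚP.≮⇒≥ (λ 1<B → <⇒≱ (ι≤⇒≤∣floor∣ 0≤B {1} (ℚP.<⇒≤ 1<B)) (≤-reflexive b≡0))
    B^≤1 : ∀ m → B ^ℚ m ℚ.≤ 1ℚ
    B^≤1 zero    = ℚP.≤-refl
    B^≤1 (suc m) = *ℚ-mono-≤ (0≤^ℚ m 0≤B) 0≤1 B≤1 (B^≤1 m)
    1≤2B : 1ℚ ℚ.≤ ι 2 ℚ.* B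
    1≤2B = ℚP.≤-trans 1≤2B^k (ℚP.*-monoˡ-≤-nonNeg (ι 2) {{ℚ.nonNegative (0≤ι 2)}}
      (ℚP.≤-trans (ℚP.*-monoˡ-≤-nonNeg B {{ℚ.nonNegative 0≤B}} (B^≤1 k)) (ℚP.≤-reflexive (ℚP.*-identityʳ B))))
    3a≤ : ι (3 * a) ℚ.≤ ι 6 ℚ.* (A ℚ.* B)
    3a≤ = begin
      ι (3 * a)                      ≡⟨ trans (ι-* 3 a) (sym (ℚP.*-identityʳ (ι 3 ℚ.* ι a))) ⟩
      ι 3 ℚ.* ι a ℚ.* 1ℚ             ≤⟨ *ℚ-mono-≤ 0≤1 (0≤* (0≤ι 3) 0≤A) (ℚP.*-monoˡ-≤-nonNeg (ι 3) {{ℚ.nonNegative (0≤ι 3)}} ιa≤A) 1≤2B ⟩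
      ι 3 ℚ.* A ℚ.* (ι 2 ℚ.* B)      ≡⟨ ℚ*.interchange (ι 3) A (ι 2) B ⟩
      ι 3 ℚ.* ι 2 ℚ.* (A ℚ.* B)      ∎

  -- The integer estimate corresponds to the exponent 1 / q. From b ≥ 1 and p ≥ 1 follow b ≤ b ^ p
  -- and then b ^ p ≤ r ^ q; comparing q-th powers keeps the argument inside ℚ.
  scale-bound : ∀ {p q} .{{_ : NonZero p}} .{{_ : NonZero q}} {C Z} .{{_ : NonZero b}} {r} →
                0ℚ ℚ.≤ r → B ^ℚ p ℚ.≤ r ^ℚ q → Z ^ q ≤ C * b → ι Z ℚ.≤ ι C ℚ.* r
  scale-bound {p} {q} {C} {Z} {r} 0≤r B^p≤r^q Z^q≤ = ^ℚ-cancel-≤ q (0≤* (0≤ι C) 0≤r) (begin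
    ι Z ^ℚ q                ≡⟨ ι-^ Z q ⟨
    ι (Z ^ q)               ≤⟨ ι-mono-≤ (≤-trans Z^q≤ (*-mono-≤ (m≤m^n C q) (m≤m^n b p))) ⟩
    ι (C ^ q * b ^ p)       ≡⟨ trans (ι-* (C ^ q) (b ^ p)) (cong₂ ℚ._*_ (ι-^ C q) (ι-^ b p)) ⟩
    ι C ^ℚ q ℚ.* ι b ^ℚ p   ≤⟨ ℚP.*-monoˡ-≤-nonNeg (ι C ^ℚ q) {{ℚ.nonNegative (0≤^ℚ q (0≤ι C))}}
                                 (ℚP.≤-trans (^ℚ-mono-≤ p (0≤ι b) ιb≤B) B^p≤r^q) ⟩
    ι C ^ℚ q ℚ.* r ^ℚ q     ≡⟨ ^ℚ-distrib-* (ι C) r q ⟨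
    (ι C ℚ.* r) ^ℚ q        ∎)
    where open ℚP.≤-Reasoning

  -- Truncated subtraction agrees with the integer exponent only for `suc k` ≤ 2 t, which is why the
  -- second alternative of `ZerosBound` records this inequality.
  powℤ-bound : suc k ≤ 2 * t → ι (b ^ (2 * t ∸ suc k)) ℚ.≤ powℤ B {{>-nonZero 0<B}} ((+ (2 * t)) ℤ.- (+ suc k))
  powℤ-bound k≤2t = ℚP.≤-trans (ℚP.≤-reflexive (ι-^ b (2 * t ∸ suc k)))
    (ℚP.≤-trans (^ℚ-mono-≤ (2 * t ∸ suc k) (0≤ι b) ιb≤B)
      (ℚP.≤-reflexive (cong (λ z → powℤ B {{>-nonZero 0<B}} z)
        (sym (trans (ℤP.[+m]-[+n]≡m⊖n (2 * t) (suc k)) (ℤP.⊖-≥ k≤2t))))))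

  -- The three parts of the constant: 6 ^ t for b = 0, C for the main term, and C * C for the second
  -- term, where Z ≤ C r brings in another factor C.
  rational-bound : ∀ {p q C} .{{_ : NonZero p}} .{{_ : NonZero q}} → ZerosBound k n q C →
    (r : ℚ) → 0ℚ ℚ.≤ r → B ^ℚ p ℚ.≤ r ^ℚ q →
    ι (#zeros (suc k) t a b) ℚ.≤
      ι (6 ^ t + C + C * C) ℚ.* ((A ℚ.* B) ^ℚ t ℚ.+ A ^ℚ n ℚ.* powℤ B {{>-nonZero 0<B}} ((+ (2 * t)) ℤ.- (+ suc k)) ℚ.* r)
  rational-bound {p} {q} {C} bound r 0≤r B^p≤r^q = by-cases (b ≟ 0)
    where
    X = (A ℚ.* B) ^ℚ t
    P = powℤ B {{>-nonZero 0<B}} ((+ (2 * t)) ℤ.- (+ suc k))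
    Y = A ^ℚ n ℚ.* P ℚ.* r
    0≤X : 0ℚ ℚ.≤ X
    0≤X = 0≤^ℚ t (0≤* 0≤A 0≤B)
    0≤P : 0ℚ ℚ.≤ P
    0≤P = 0≤powℤ 0<B ((+ (2 * t)) ℤ.- (+ suc k))
    0≤Y : 0ℚ ℚ.≤ Y
    0≤Y = 0≤* (0≤* (0≤^ℚ n 0≤A) 0≤P) 0≤r
    6^t≤ : 6 ^ t ≤ 6 ^ t + C + C * C
    6^t≤ = ≤-trans (m≤m+n (6 ^ t) C) (m≤m+n (6 ^ t + C) (C * C))
    C≤ : C ≤ 6 ^ t + C + C * C
    C≤ = ≤-trans (m≤n+m C (6 ^ t)) (m≤m+n (6 ^ t + C) (C * C))
    C*C≤ : C * C ≤ 6 ^ t + C + C * C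
    C*C≤ = m≤n+m (C * C) (6 ^ t + C)
    0≤CCY : 0ℚ ℚ.≤ ι (C * C) ℚ.* Y
    0≤CCY = 0≤* (0≤ι (C * C)) 0≤Y
    conclude : ∀ {c} → c ≤ 6 ^ t + C + C * C →
               ι (#zeros (suc k) t a b) ℚ.≤ ι c ℚ.* X ℚ.+ ι (C * C) ℚ.* Y →
               ι (#zeros (suc k) t a b) ℚ.≤ ι (6 ^ t + C + C * C) ℚ.* (X ℚ.+ Y)
    conclude {c} c≤ = ι-combine-≤ {c = c} {d = C * C} {C = 6 ^ t + C + C * C} 0≤X 0≤Y c≤ C*C≤
    by-cases : Dec (b ≡ 0) → ι (#zeros (suc k) t a b) ℚ.≤ ι (6 ^ t + C + C * C) ℚ.* (X ℚ.+ Y)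
    by-cases (yes b≡0) = conclude {6 ^ t} 6^t≤ (≤-+ʳ 0≤CCY (#zeros-b≡0 b≡0))
    by-cases (no b≢0) = by-size (bound a b 2b^k≤a)
      where
      instance
        b≢0′ : NonZero b
        b≢0′ = ℕ.≢-nonZero b≢0
      open ℚP.≤-Reasoning
      by-size : _ → ι (#zeros (suc k) t a b) ℚ.≤ ι (6 ^ t + C + C * C) ℚ.* (X ℚ.+ Y)
      by-size (inj₁ few) = conclude {C} C≤ (≤-+ʳ 0≤CCY (begin
        ι (#zeros (suc k) t a b)    ≤⟨ ι-mono-≤ few ⟩
        ι (C * (a * b) ^ t)         ≡⟨ ι-* C ((a * b) ^ t) ⟩
        ι C ℚ.* ι ((a * b) ^ t)     ≤⟨ ℚP.*-monoˡ-≤-nonNeg (ι C) {{ℚ.nonNegative (0≤ι C)}} floor-ab-bound ⟩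
        ι C ℚ.* X                   ∎))
      by-size (inj₂ (k≤2t , Z , Z^q≤ , many)) = conclude {C} C≤ (begin
        ι (#zeros (suc k) t a b)    ≤⟨ ι-mono-≤ many ⟩
        ι (C * ((a * b) ^ t + y))   ≡⟨ trans (ι-* C ((a * b) ^ t + y)) (cong (ι C ℚ.*_) (ι-+ ((a * b) ^ t) y)) ⟩
        ι C ℚ.* (ι ((a * b) ^ t) ℚ.+ ι y)
                                    ≤⟨ ℚP.*-monoˡ-≤-nonNeg (ι C) {{ℚ.nonNegative (0≤ι C)}} (ℚP.+-mono-≤ floor-ab-bound y≤) ⟩
        ι C ℚ.* (X ℚ.+ A ^ℚ n ℚ.* P ℚ.* (ι C ℚ.* r))
                                    ≡⟨ ℚP.*-distribˡ-+ (ι C) X _ ⟩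
        ι C ℚ.* X ℚ.+ ι C ℚ.* (A ^ℚ n ℚ.* P ℚ.* (ι C ℚ.* r))
                                    ≡⟨ cong (λ z → ι C ℚ.* X ℚ.+ z) (trans (cong (ι C ℚ.*_) (ℚ*.x∙yz≈y∙xz (A ^ℚ n ℚ.* P) (ι C) r))
                                         (trans (sym (ℚP.*-assoc (ι C) (ι C) Y)) (cong (ℚ._* Y) (sym (ι-* C C))))) ⟩
        ι C ℚ.* X ℚ.+ ι (C * C) ℚ.* Y ∎)
        where
        y = a ^ n * b ^ (2 * t ∸ suc k) * Z
        y≤ : ι y ℚ.≤ A ^ℚ n ℚ.* P ℚ.* (ι C ℚ.* r)
        y≤ = begin
          ι y                                            ≡⟨ trans (ι-* (a ^ n * b ^ (2 * t ∸ suc k)) Z)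
                                                              (cong (ℚ._* ι Z) (trans (ι-* (a ^ n) (b ^ (2 * t ∸ suc k)))
                                                                (cong (ℚ._* ι (b ^ (2 * t ∸ suc k))) (ι-^ a n)))) ⟩
          ι a ^ℚ n ℚ.* ι (b ^ (2 * t ∸ suc k)) ℚ.* ι Z   ≤⟨ *ℚ-mono-≤ (0≤ι Z) (0≤* (0≤^ℚ n 0≤A) 0≤P)
                                                              (*ℚ-mono-≤ (0≤ι (b ^ (2 * t ∸ suc k))) (0≤^ℚ n 0≤A)
                                                                (^ℚ-mono-≤ n (0≤ι a) ιa≤A) (powℤ-bound k≤2t))
                                                              (scale-bound {p} {q} {C} {Z} 0≤r B^p≤r^q Z^q≤) ⟩
          A ^ℚ n ℚ.* P ℚ.* (ι C ℚ.* r)                   ∎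

theorem2p5 : (k t : ℕ) → 3 ≤ k → 2 ≤ t →
  -- ε = p / q with p, q ≥ 1 ranges over all positive rationals
  (p q : ℕ) → .{{_ : ℕ.NonZero p}} → .{{_ : ℕ.NonZero q}} →
  Σ ℕ λ C →
    (A B : ℚ) → (B>0 : 0ℚ ℚ.< B) →
    toℚ (+ 2) ℚ.* (B ^ℚ k) ℚ.≤ A → 1ℚ ℚ.≤ toℚ (+ 2) ℚ.* (B ^ℚ k) →
    -- r is any rational upper bound for B^(p/q)  (i.e. r ≥ 0 and r^q ≥ B^p)
    (r : ℚ) → 0ℚ ℚ.≤ r → B ^ℚ p ℚ.≤ r ^ℚ q →
    toℚ (+ U k t A B)
      ℚ.≤ toℚ (+ C) ℚ.* (((A ℚ.* B) ^ℚ t)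
            ℚ.+ (A ^ℚ (t ∸ 1)) ℚ.* powℤ B {{>-nonZero B>0}} ((+ (2 ℕ.* t)) ℤ.- (+ k)) ℚ.* r)
theorem2p5 (suc k) (suc n) 3≤k 2≤t p q = 6 ^ suc n + C + C * C , λ A B B>0 2B^k≤A 1≤2B^k r 0≤r B^p≤r^q →
  ℚP.≤-trans (ι-mono-≤ (U≤#zeros (suc k) (suc n) A B))
             (rational-bound k n A B B>0 2B^k≤A 1≤2B^k {p} {q} {C} (proj₂ (zerosBound k n q)) r 0≤r B^p≤r^q)
  where
  C : ℕ
  C = proj₁ (zerosBound k n q)
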